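{- Let $k$ be a positive integer. An oriented graph with underlying graph the hypercube $Q_k$ and optimum Hermitian energy is unique up to switching equivalence; that is, if $Q_k^{\phi_1}$ and $Q_k^{\phi_2}$ are two oriented graphs obtained by orienting all edges of $Q_k$, and both have optimum Hermitian energy, then $Q_k^{\phi_1}$ and $Q_k^{\phi_2}$ are switching equivalent.
   Context: The hypercube $Q_k$ is defined recursively by $Q_1=K_2$ and $Q_k=Q_{k-1}\Box Q_1$ (Cartesian product) for $k\ge 2$. It is $k$-regular on $n=2^k$ vertices. An oriented graph $G^\phi$ is obtained from a finite simple undirected graph $G$ (its underlying graph) by giving every edge an orientation; $u\to v$ denotes an arc. Its Hermitian-adjacency matrix $H(G^\phi)=(h_{kl})$ has $h_{kl}=i$ and $h_{lk}=-i$ if $k\to l$, and $h_{kl}=0$ if $k,l$ are not adjacent, where $i$ is the imaginary unit. The Hermitian energy $\mathcal{E}_H(G^\phi)$ is the sum of the absolute values of the eigenvalues of $H(G^\phi)$. A graph $G^\phi$ on $n$ vertices with maximum degree $\Delta$ has optimum Hermitian energy if $\mathcal{E}_H(G^\phi)=n\sqrt{\Delta}$; for underlying graph $Q_k$ this means $\mathcal{E}_H=2^k\sqrt{k}$. Two oriented graphs $G^{\phi_1},G^{\phi_2}$ with the same underlying graph and the same vertex set are switching equivalent if there is a diagonal matrix $D$ with all diagonal entries in $\{1,-1\}$ such that $H(G^{\phi_2})=D^{ -1}H(G^{\phi_1})D$. -}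

module Defs where

open import Algebra.Bundles.Raw using (RawMonoid)
import Algebra.Definitions.RawMonoid as RawMonoidDefs
open import Data.Fin.Base using (Fin; remQuot)
open import Data.Fin.Properties using () renaming (_≟_ to _≟ᶠ_)
open import Data.Integer.Base using (+_)
open import Data.List.Base using (allFin; filter; length; map)
open import Data.List.Extrema.Nat using (max)
open import Data.Nat.Base as ℕ using (ℕ; zero; suc; NonZero)
import Data.Nat.Properties as ℕₚ
open import Data.Product.Base using (Σ; ∃; ∃₂; _×_; _,_; proj₁; proj₂)
open import Data.Rational.Base as ℚ using (ℚ; 0ℚ; 1ℚ; ½)
import Data.Rational.Properties as ℚₚ
open import Data.Rational.Solver using (module +-*-Solver)
open import Data.Sum.Base as Sum using (_⊎_; inj₁; inj₂)
open import Relation.Binary.Core using (Rel)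
open import Relation.Binary.Definitions
  using (Asymmetric; Decidable; Irreflexive; Symmetric)
open import Relation.Binary.PropositionalEquality
  using (_≡_; _≢_; refl; sym; trans; cong; cong₂; subst)
open import Relation.Nullary.Decidable using (yes; no; ¬?; _×-dec_; _⊎-dec_)
open import Level using (0ℓ)

-- Cauchy sequences of rationals; real numbers are compared with _≃_ below,
-- never with _≡_.

IsCauchy : (ℕ → ℚ) → Set
IsCauchy x = ∀ ε → 0ℚ ℚ.< ε →
  ∃ λ N → ∀ m n → N ℕ.≤ m → N ℕ.≤ n → ℚ.∣ x m ℚ.- x n ∣ ℚ.< ε

record ℝ : Set where
  constructor mkℝ
  field
    seq    : ℕ → ℚ
    cauchy : IsCauchy seq

open ℝ public

infix 4 _≃_ _≤ʳ_

record _≃_ (x y : ℝ) : Set where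
  constructor mk≃
  field
    difference→0 : ∀ ε → 0ℚ ℚ.< ε →
      ∃ λ N → ∀ n → N ℕ.≤ n → ℚ.∣ seq x n ℚ.- seq y n ∣ ℚ.< ε

open _≃_ public

record _≤ʳ_ (x y : ℝ) : Set where
  constructor mk≤ʳ
  field
    eventually≤ : ∀ ε → 0ℚ ℚ.< ε →
      ∃ λ N → ∀ n → N ℕ.≤ n → seq x n ℚ.≤ seq y n ℚ.+ ε

open _≤ʳ_ public

half-pos : ∀ {ε} → 0ℚ ℚ.< ε → 0ℚ ℚ.< ½ ℚ.* ε
half-pos {ε} 0<ε = subst (ℚ._< ½ ℚ.* ε) (ℚₚ.*-zeroʳ ½) (ℚₚ.*-monoʳ-<-pos ½ 0<ε)

halves : ∀ ε → ½ ℚ.* ε ℚ.+ ½ ℚ.* ε ≡ ε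
halves ε = trans (sym (ℚₚ.*-distribʳ-+ ε ½ ½)) (ℚₚ.*-identityˡ ε)

const-cauchy : ∀ q → IsCauchy (λ _ → q)
const-cauchy q ε 0<ε = 0 , λ _ _ _ _ →
  subst (ℚ._< ε) (sym (cong ℚ.∣_∣ (ℚₚ.+-inverseʳ q))) 0<ε

+-cauchy : ∀ x y → IsCauchy x → IsCauchy y → IsCauchy (λ n → x n ℚ.+ y n)
+-cauchy x y cx cy ε 0<ε with cx (½ ℚ.* ε) (half-pos 0<ε) | cy (½ ℚ.* ε) (half-pos 0<ε)
... | N₁ , p | N₂ , q = N₁ ℕ.⊔ N₂ , bound
  where
  open ℚₚ.≤-Reasoning
  open +-*-Solver
  bound : ∀ m n → N₁ ℕ.⊔ N₂ ℕ.≤ m → N₁ ℕ.⊔ N₂ ℕ.≤ n →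
          ℚ.∣ (x m ℚ.+ y m) ℚ.- (x n ℚ.+ y n) ∣ ℚ.< ε
  bound m n N≤m N≤n = begin-strict
    ℚ.∣ (x m ℚ.+ y m) ℚ.- (x n ℚ.+ y n) ∣
      ≡⟨ cong ℚ.∣_∣ (solve 4 (λ a b c d → (a :+ b) :- (c :+ d) := (a :- c) :+ (b :- d))
                      refl (x m) (y m) (x n) (y n)) ⟩
    ℚ.∣ (x m ℚ.- x n) ℚ.+ (y m ℚ.- y n) ∣
      ≤⟨ ℚₚ.∣p+q∣≤∣p∣+∣q∣ (x m ℚ.- x n) (y m ℚ.- y n) ⟩
    ℚ.∣ x m ℚ.- x n ∣ ℚ.+ ℚ.∣ y m ℚ.- y n ∣
      <⟨ ℚₚ.+-mono-<
           (p m n (ℕₚ.m⊔n≤o⇒m≤o N₁ N₂ N≤m) (ℕₚ.m⊔n≤o⇒m≤o N₁ N₂ N≤n))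
           (q m n (ℕₚ.m⊔n≤o⇒n≤o N₁ N₂ N≤m) (ℕₚ.m⊔n≤o⇒n≤o N₁ N₂ N≤n)) ⟩
    ½ ℚ.* ε ℚ.+ ½ ℚ.* ε
      ≡⟨ halves ε ⟩
    ε ∎

neg-cauchy : ∀ x → IsCauchy x → IsCauchy (λ n → ℚ.- x n)
neg-cauchy x cx ε 0<ε with cx ε 0<ε
... | N , p = N , λ m n N≤m N≤n →
  subst (ℚ._< ε)
    (trans (sym (ℚₚ.∣-p∣≡∣p∣ (x m ℚ.- x n)))
      (cong ℚ.∣_∣ (solve 2 (λ a b → :- (a :- b) := (:- a) :- (:- b)) refl (x m) (x n))))
    (p m n N≤m N≤n)
  where open +-*-Solver

∣p∣≤∣q∣+∣p-q∣ : ∀ p q → ℚ.∣ p ∣ ℚ.≤ ℚ.∣ q ∣ ℚ.+ ℚ.∣ p ℚ.- q ∣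
∣p∣≤∣q∣+∣p-q∣ p q = begin
  ℚ.∣ p ∣                     ≡⟨ cong ℚ.∣_∣ (solve 2 (λ a b → a := b :+ (a :- b)) refl p q) ⟩
  ℚ.∣ q ℚ.+ (p ℚ.- q) ∣       ≤⟨ ℚₚ.∣p+q∣≤∣p∣+∣q∣ q (p ℚ.- q) ⟩
  ℚ.∣ q ∣ ℚ.+ ℚ.∣ p ℚ.- q ∣   ∎
  where
  open ℚₚ.≤-Reasoning
  open +-*-Solver

∣p-q∣≡∣q-p∣ : ∀ p q → ℚ.∣ p ℚ.- q ∣ ≡ ℚ.∣ q ℚ.- p ∣
∣p-q∣≡∣q-p∣ p q = trans (sym (ℚₚ.∣-p∣≡∣p∣ (p ℚ.- q)))
  (cong ℚ.∣_∣ (solve 2 (λ a b → :- (a :- b) := b :- a) refl p q))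
  where open +-*-Solver

∣p∣-∣q∣≤∣p-q∣ : ∀ p q → ℚ.∣ p ∣ ℚ.- ℚ.∣ q ∣ ℚ.≤ ℚ.∣ p ℚ.- q ∣
∣p∣-∣q∣≤∣p-q∣ p q = begin
  ℚ.∣ p ∣ ℚ.- ℚ.∣ q ∣
    ≤⟨ ℚₚ.+-monoˡ-≤ (ℚ.- ℚ.∣ q ∣) (∣p∣≤∣q∣+∣p-q∣ p q) ⟩
  (ℚ.∣ q ∣ ℚ.+ ℚ.∣ p ℚ.- q ∣) ℚ.- ℚ.∣ q ∣
    ≡⟨ solve 2 (λ a b → (a :+ b) :- a := b) refl ℚ.∣ q ∣ ℚ.∣ p ℚ.- q ∣ ⟩
  ℚ.∣ p ℚ.- q ∣ ∎
  where
  open ℚₚ.≤-Reasoning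
  open +-*-Solver

∣∣p∣-∣q∣∣≤∣p-q∣ : ∀ p q → ℚ.∣ ℚ.∣ p ∣ ℚ.- ℚ.∣ q ∣ ∣ ℚ.≤ ℚ.∣ p ℚ.- q ∣
∣∣p∣-∣q∣∣≤∣p-q∣ p q with ℚₚ.∣p∣≡p∨∣p∣≡-p (ℚ.∣ p ∣ ℚ.- ℚ.∣ q ∣)
... | inj₁ e = subst (ℚ._≤ ℚ.∣ p ℚ.- q ∣) (sym e) (∣p∣-∣q∣≤∣p-q∣ p q)
... | inj₂ e = begin
  ℚ.∣ ℚ.∣ p ∣ ℚ.- ℚ.∣ q ∣ ∣     ≡⟨ e ⟩
  ℚ.- (ℚ.∣ p ∣ ℚ.- ℚ.∣ q ∣)     ≡⟨ solve 2 (λ a b → :- (a :- b) := b :- a) refl ℚ.∣ p ∣ ℚ.∣ q ∣ ⟩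
  ℚ.∣ q ∣ ℚ.- ℚ.∣ p ∣           ≤⟨ ∣p∣-∣q∣≤∣p-q∣ q p ⟩
  ℚ.∣ q ℚ.- p ∣                 ≡⟨ ∣p-q∣≡∣q-p∣ q p ⟩
  ℚ.∣ p ℚ.- q ∣                 ∎
  where
  open ℚₚ.≤-Reasoning
  open +-*-Solver

abs-cauchy : ∀ x → IsCauchy x → IsCauchy (λ n → ℚ.∣ x n ∣)
abs-cauchy x cx ε 0<ε with cx ε 0<ε
... | N , p = N , λ m n N≤m N≤n →
  ℚₚ.≤-<-trans (∣∣p∣-∣q∣∣≤∣p-q∣ (x m) (x n)) (p m n N≤m N≤n)

0<1 : 0ℚ ℚ.< 1ℚ
0<1 = ℚₚ.positive⁻¹ 1ℚ

eventually-bounded : ∀ x → IsCauchy x →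
  ∃₂ λ B N → 0ℚ ℚ.< B × (∀ n → N ℕ.≤ n → ℚ.∣ x n ∣ ℚ.≤ B)
eventually-bounded x cx with cx 1ℚ 0<1
... | N , p = ℚ.∣ x N ∣ ℚ.+ 1ℚ , N
  , ℚₚ.+-mono-≤-< (ℚₚ.0≤∣p∣ (x N)) 0<1
  , λ n N≤n → ℚₚ.≤-trans (∣p∣≤∣q∣+∣p-q∣ (x n) (x N))
      (ℚₚ.+-monoʳ-≤ ℚ.∣ x N ∣ (ℚₚ.<⇒≤ (p n N N≤n ℕₚ.≤-refl)))

scale : ∀ {B ε} → 0ℚ ℚ.< B → 0ℚ ℚ.< ε → ∃ λ δ → 0ℚ ℚ.< δ × B ℚ.* δ ≡ ε
scale {B} {ε} 0<B 0<ε = B⁻¹ ℚ.* ε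
  , subst (ℚ._< B⁻¹ ℚ.* ε) (ℚₚ.*-zeroʳ B⁻¹) (ℚₚ.*-monoʳ-<-pos B⁻¹ 0<ε)
  , trans (sym (ℚₚ.*-assoc B B⁻¹ ε))
      (trans (cong (ℚ._* ε) (ℚₚ.*-inverseʳ B)) (ℚₚ.*-identityˡ ε))
  where
  instance
    B-pos = ℚ.positive 0<B
    B-nonZero = ℚₚ.pos⇒nonZero B
  B⁻¹ = ℚ.1/ B
  instance B⁻¹-pos = ℚₚ.1/pos⇒pos B

∣p*q∣<B*δ : ∀ {p q B δ} → 0ℚ ℚ.< B → ℚ.∣ p ∣ ℚ.≤ B → ℚ.∣ q ∣ ℚ.< δ →
            ℚ.∣ p ℚ.* q ∣ ℚ.< B ℚ.* δ
∣p*q∣<B*δ {p} {q} {B} {δ} 0<B p≤B q<δ = begin-strict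
  ℚ.∣ p ℚ.* q ∣        ≡⟨ ℚₚ.∣p*q∣≡∣p∣*∣q∣ p q ⟩
  ℚ.∣ p ∣ ℚ.* ℚ.∣ q ∣  ≤⟨ ℚₚ.*-monoʳ-≤-nonNeg ℚ.∣ q ∣ {{ℚ.nonNegative (ℚₚ.0≤∣p∣ q)}} p≤B ⟩
  B ℚ.* ℚ.∣ q ∣        <⟨ ℚₚ.*-monoʳ-<-pos B {{ℚ.positive 0<B}} q<δ ⟩
  B ℚ.* δ              ∎
  where open ℚₚ.≤-Reasoning

*-difference : ∀ a b c d →
  a ℚ.* b ℚ.- c ℚ.* d ≡ a ℚ.* (b ℚ.- d) ℚ.+ d ℚ.* (a ℚ.- c)
*-difference = solve 4 (λ a b c d → a :* b :- c :* d := a :* (b :- d) :+ d :* (a :- c)) refl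
  where open +-*-Solver

*-difference-< : ∀ {a b c d B C δ γ} → 0ℚ ℚ.< B → 0ℚ ℚ.< C →
  ℚ.∣ a ∣ ℚ.≤ B → ℚ.∣ b ℚ.- d ∣ ℚ.< δ → ℚ.∣ d ∣ ℚ.≤ C → ℚ.∣ a ℚ.- c ∣ ℚ.< γ →
  ℚ.∣ a ℚ.* b ℚ.- c ℚ.* d ∣ ℚ.< B ℚ.* δ ℚ.+ C ℚ.* γ
*-difference-< {a} {b} {c} {d} {B} {C} {δ} {γ} 0<B 0<C a≤B b-d<δ d≤C a-c<γ = begin-strict
  ℚ.∣ a ℚ.* b ℚ.- c ℚ.* d ∣
    ≡⟨ cong ℚ.∣_∣ (*-difference a b c d) ⟩
  ℚ.∣ a ℚ.* (b ℚ.- d) ℚ.+ d ℚ.* (a ℚ.- c) ∣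
    ≤⟨ ℚₚ.∣p+q∣≤∣p∣+∣q∣ (a ℚ.* (b ℚ.- d)) (d ℚ.* (a ℚ.- c)) ⟩
  ℚ.∣ a ℚ.* (b ℚ.- d) ∣ ℚ.+ ℚ.∣ d ℚ.* (a ℚ.- c) ∣
    <⟨ ℚₚ.+-mono-< (∣p*q∣<B*δ {a} {b ℚ.- d} 0<B a≤B b-d<δ)
                   (∣p*q∣<B*δ {d} {a ℚ.- c} 0<C d≤C a-c<γ) ⟩
  B ℚ.* δ ℚ.+ C ℚ.* γ ∎
  where open ℚₚ.≤-Reasoning

*-cauchy : ∀ x y → IsCauchy x → IsCauchy y → IsCauchy (λ n → x n ℚ.* y n)
*-cauchy x y cx cy ε 0<ε = N , λ m n N≤m N≤n →
  subst (ℚ.∣ x m ℚ.* y m ℚ.- x n ℚ.* y n ∣ ℚ.<_)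
    (trans (cong₂ ℚ._+_ Bδ≡ε/2 Cγ≡ε/2) (halves ε))
    (*-difference-< {x m} {y m} {x n} {y n} 0<B 0<C
      (x≤B m (ℕₚ.≤-trans N₁≤N N≤m))
      (y-close m n (ℕₚ.≤-trans N₃≤N N≤m) (ℕₚ.≤-trans N₃≤N N≤n))
      (y≤C n (ℕₚ.≤-trans N₂≤N N≤n))
      (x-close m n (ℕₚ.≤-trans N₄≤N N≤m) (ℕₚ.≤-trans N₄≤N N≤n)))
  where
  B = proj₁ (eventually-bounded x cx)
  C = proj₁ (eventually-bounded y cy)
  N₁ = proj₁ (proj₂ (eventually-bounded x cx))
  N₂ = proj₁ (proj₂ (eventually-bounded y cy))
  0<B = proj₁ (proj₂ (proj₂ (eventually-bounded x cx)))
  0<C = proj₁ (proj₂ (proj₂ (eventually-bounded y cy)))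
  x≤B = proj₂ (proj₂ (proj₂ (eventually-bounded x cx)))
  y≤C = proj₂ (proj₂ (proj₂ (eventually-bounded y cy)))
  δ-data : ∃ λ δ → 0ℚ ℚ.< δ × B ℚ.* δ ≡ ½ ℚ.* ε
  δ-data = scale 0<B (half-pos 0<ε)
  γ-data : ∃ λ γ → 0ℚ ℚ.< γ × C ℚ.* γ ≡ ½ ℚ.* ε
  γ-data = scale 0<C (half-pos 0<ε)
  Bδ≡ε/2 = proj₂ (proj₂ δ-data)
  Cγ≡ε/2 = proj₂ (proj₂ γ-data)
  N₃ = proj₁ (cy (proj₁ δ-data) (proj₁ (proj₂ δ-data)))
  N₄ = proj₁ (cx (proj₁ γ-data) (proj₁ (proj₂ γ-data)))
  y-close = proj₂ (cy (proj₁ δ-data) (proj₁ (proj₂ δ-data)))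
  x-close = proj₂ (cx (proj₁ γ-data) (proj₁ (proj₂ γ-data)))
  N = (N₁ ℕ.⊔ N₂) ℕ.⊔ (N₃ ℕ.⊔ N₄)
  N₁≤N : N₁ ℕ.≤ N
  N₁≤N = ℕₚ.m≤n⇒m≤n⊔o (N₃ ℕ.⊔ N₄) (ℕₚ.m≤m⊔n N₁ N₂)
  N₂≤N : N₂ ℕ.≤ N
  N₂≤N = ℕₚ.m≤n⇒m≤n⊔o (N₃ ℕ.⊔ N₄) (ℕₚ.m≤n⊔m N₁ N₂)
  N₃≤N : N₃ ℕ.≤ N
  N₃≤N = ℕₚ.m≤n⇒m≤o⊔n (N₁ ℕ.⊔ N₂) (ℕₚ.m≤m⊔n N₃ N₄)
  N₄≤N : N₄ ℕ.≤ N
  N₄≤N = ℕₚ.m≤n⇒m≤o⊔n (N₁ ℕ.⊔ N₂) (ℕₚ.m≤n⊔m N₃ N₄)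

-- Opaque, so that normalising a real number does not unfold these proofs.
abstract
  const-isCauchy : ∀ q → IsCauchy (λ _ → q)
  const-isCauchy = const-cauchy

  +-isCauchy : ∀ x y → IsCauchy x → IsCauchy y → IsCauchy (λ n → x n ℚ.+ y n)
  +-isCauchy = +-cauchy

  *-isCauchy : ∀ x y → IsCauchy x → IsCauchy y → IsCauchy (λ n → x n ℚ.* y n)
  *-isCauchy = *-cauchy

  neg-isCauchy : ∀ x → IsCauchy x → IsCauchy (λ n → ℚ.- x n)
  neg-isCauchy = neg-cauchy

  abs-isCauchy : ∀ x → IsCauchy x → IsCauchy (λ n → ℚ.∣ x n ∣)
  abs-isCauchy = abs-cauchy

infixl 6 _+ʳ_
infixl 7 _*ʳ_
infix  8 -ʳ_

fromℕ : ℕ → ℝ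
fromℕ n = mkℝ (λ _ → + n ℚ./ 1) (const-isCauchy (+ n ℚ./ 1))

0ʳ 1ʳ : ℝ
0ʳ = fromℕ 0
1ʳ = fromℕ 1

_+ʳ_ _*ʳ_ : ℝ → ℝ → ℝ
x +ʳ y = mkℝ (λ n → seq x n ℚ.+ seq y n) (+-isCauchy (seq x) (seq y) (cauchy x) (cauchy y))
x *ʳ y = mkℝ (λ n → seq x n ℚ.* seq y n) (*-isCauchy (seq x) (seq y) (cauchy x) (cauchy y))

-ʳ_ : ℝ → ℝ
-ʳ x = mkℝ (λ n → ℚ.- seq x n) (neg-isCauchy (seq x) (cauchy x))

∣_∣ʳ : ℝ → ℝ
∣ x ∣ʳ = mkℝ (λ n → ℚ.∣ seq x n ∣) (abs-isCauchy (seq x) (cauchy x))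

+ʳ-rawMonoid : RawMonoid 0ℓ 0ℓ
+ʳ-rawMonoid = record { Carrier = ℝ ; _≈_ = _≃_ ; _∙_ = _+ʳ_ ; ε = 0ʳ }

open RawMonoidDefs +ʳ-rawMonoid public using () renaming (sum to ∑ʳ)

IsSqrt : ℝ → ℝ → Set
IsSqrt s x = 0ʳ ≤ʳ s × s *ʳ s ≃ x

infix 4 _≈ᶜ_ _≈ᵛ_ _≈ᵐ_

record ℂ : Set where
  constructor _+i_
  field
    re im : ℝ

open ℂ public

record _≈ᶜ_ (z w : ℂ) : Set where
  constructor mk≈ᶜ
  field
    re≃ : re z ≃ re w
    im≃ : im z ≃ im w

open _≈ᶜ_ public

infixl 6 _+ᶜ_
infixl 7 _*ᶜ_ _·ᵛ_ _·ᵐ_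
infix  8 -ᶜ_

fromℝ : ℝ → ℂ
fromℝ x = x +i 0ʳ

0ᶜ 1ᶜ i : ℂ
0ᶜ = fromℝ 0ʳ
1ᶜ = fromℝ 1ʳ
i  = 0ʳ +i 1ʳ

_+ᶜ_ _*ᶜ_ : ℂ → ℂ → ℂ
z +ᶜ w = (re z +ʳ re w) +i (im z +ʳ im w)
z *ᶜ w = (re z *ʳ re w +ʳ -ʳ (im z *ʳ im w)) +i (re z *ʳ im w +ʳ im z *ʳ re w)

-ᶜ_ : ℂ → ℂ
-ᶜ z = (-ʳ re z) +i (-ʳ im z)

+ᶜ-rawMonoid : RawMonoid 0ℓ 0ℓ
+ᶜ-rawMonoid = record { Carrier = ℂ ; _≈_ = _≈ᶜ_ ; _∙_ = _+ᶜ_ ; ε = 0ᶜ }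

open RawMonoidDefs +ᶜ-rawMonoid public using () renaming (sum to ∑ᶜ)

Vec : ℕ → Set
Vec n = Fin n → ℂ

Matrix : ℕ → Set
Matrix n = Fin n → Fin n → ℂ

_≈ᵛ_ : ∀ {n} → Rel (Vec n) 0ℓ
v ≈ᵛ w = ∀ k → v k ≈ᶜ w k

_≈ᵐ_ : ∀ {n} → Rel (Matrix n) 0ℓ
A ≈ᵐ B = ∀ k l → A k l ≈ᶜ B k l

_·ᵛ_ : ∀ {n} → Matrix n → Vec n → Vec n
(A ·ᵛ v) k = ∑ᶜ λ l → A k l *ᶜ v l

_·ᵐ_ : ∀ {n} → Matrix n → Matrix n → Matrix n
(A ·ᵐ B) k l = ∑ᶜ λ m → A k m *ᶜ B m l

identity : ∀ {n} → Matrix n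
identity k l with k ≟ᶠ l
... | yes _ = 1ᶜ
... | no  _ = 0ᶜ

combination : ∀ {n} → (Fin n → ℂ) → (Fin n → Vec n) → Vec n
combination c v k = ∑ᶜ λ j → c j *ᶜ v j k

record IsBasis {n} (v : Fin n → Vec n) : Set where
  field
    independent : ∀ c → combination c v ≈ᵛ (λ _ → 0ᶜ) → ∀ j → c j ≈ᶜ 0ᶜ
    spanning    : ∀ w → ∃ λ c → combination c v ≈ᵛ w

-- The eigenvalues of A listed with multiplicity: the eigenvalue of each member
-- of a basis of ℂⁿ consisting of eigenvectors (which are nonzero by linear
-- independence). They are taken real, as those of a Hermitian matrix are.
record Spectrum {n} (A : Matrix n) : Set where
  field
    eigenvalue  : Fin n → ℝ
    eigenvector : Fin n → Vec n
    isBasis     : IsBasis eigenvector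
    isEigen     : ∀ j → A ·ᵛ eigenvector j ≈ᵛ (λ k → fromℝ (eigenvalue j) *ᶜ eigenvector j k)

open Spectrum public

record Graph : Set₁ where
  field
    order    : ℕ
    _~_      : Rel (Fin order) 0ℓ
    _~?_     : Decidable _~_
    ~-sym    : Symmetric _~_
    ~-irrefl : Irreflexive _≡_ _~_

  Vertex : Set
  Vertex = Fin order

  degree : Vertex → ℕ
  degree u = length (filter (u ~?_) (allFin order))

  maxDegree : ℕ
  maxDegree = max 0 (map degree (allFin order))

record Orientation (G : Graph) : Set₁ where
  open Graph G
  infix 4 _⟶_ _⟶?_
  field
    _⟶_      : Rel Vertex 0ℓ
    _⟶?_     : Decidable _⟶_
    arc⇒edge : ∀ {u v} → u ⟶ v → u ~ v
    edge⇒arc : ∀ {u v} → u ~ v → u ⟶ v ⊎ v ⟶ u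
    asym     : Asymmetric _⟶_

hermitianAdjacency : ∀ {G} → Orientation G → Matrix (Graph.order G)
hermitianAdjacency φ k l with Orientation._⟶?_ φ k l | Orientation._⟶?_ φ l k
... | yes _ | _     = i
... | no  _ | yes _ = -ᶜ i
... | no  _ | no  _ = 0ᶜ

HasHermitianEnergy : ∀ {G} → Orientation G → ℝ → Set
HasHermitianEnergy φ e =
  Σ (Spectrum (hermitianAdjacency φ)) λ S → e ≃ ∑ʳ (λ j → ∣ eigenvalue S j ∣ʳ)

HasOptimumEnergy : ∀ {G} → Orientation G → Set
HasOptimumEnergy {G} φ =
  ∃₂ λ e s → HasHermitianEnergy φ e × IsSqrt s (fromℕ maxDegree) × e ≃ fromℕ order *ʳ s
  where open Graph G

IsSignDiagonal : ∀ {n} → Matrix n → Set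
IsSignDiagonal D =
  (∀ k → D k k ≈ᶜ 1ᶜ ⊎ D k k ≈ᶜ -ᶜ 1ᶜ) × (∀ k l → k ≢ l → D k l ≈ᶜ 0ᶜ)

AreInverse : ∀ {n} → Matrix n → Matrix n → Set
AreInverse A B = A ·ᵐ B ≈ᵐ identity × B ·ᵐ A ≈ᵐ identity

SwitchingEquivalent : ∀ {G} → Orientation G → Orientation G → Set
SwitchingEquivalent φ₁ φ₂ =
  ∃₂ λ D D⁻¹ → IsSignDiagonal D × AreInverse D D⁻¹ ×
    hermitianAdjacency φ₂ ≈ᵐ (D⁻¹ ·ᵐ hermitianAdjacency φ₁) ·ᵐ D

K₂ : Graph
K₂ = record
  { order    = 2
  ; _~_      = _≢_
  ; _~?_     = λ u v → ¬? (u ≟ᶠ v)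
  ; ~-sym    = λ u≢v v≡u → u≢v (sym v≡u)
  ; ~-irrefl = λ u≡v u≢v → u≢v u≡v
  }

infixl 7 _□_

-- The vertex set V(G) × V(H) is identified with Fin (order G * order H)
-- through the bijection remQuot.
_□_ : Graph → Graph → Graph
G □ H = record
  { order    = G.order ℕ.* H.order
  ; _~_      = λ x y → Adj (remQuot H.order x) (remQuot H.order y)
  ; _~?_     = λ x y → adj? (remQuot H.order x) (remQuot H.order y)
  ; ~-sym    = Sum.map (λ (e , a) → sym e , H.~-sym a) (λ (a , e) → G.~-sym a , sym e)
  ; ~-irrefl = λ { refl (inj₁ (_ , a)) → H.~-irrefl refl a
                 ; refl (inj₂ (a , _)) → G.~-irrefl refl a }
  }
  where
  module G = Graph G
  module H = Graph H

  Adj : Rel (G.Vertex × H.Vertex) 0ℓ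
  Adj (u , v) (u′ , v′) = (u ≡ u′ × v H.~ v′) ⊎ (u G.~ u′ × v ≡ v′)

  adj? : Decidable Adj
  adj? (u , v) (u′ , v′) =
    ((u ≟ᶠ u′) ×-dec (v H.~? v′)) ⊎-dec ((u G.~? u′) ×-dec (v ≟ᶠ v′))

hypercube : (k : ℕ) → .{{NonZero k}} → Graph
hypercube (suc zero)    = K₂
hypercube (suc (suc k)) = hypercube (suc k) □ hypercube 1

{-# OPTIONS --safe #-}
-- If H v_j = λ_j v_j for a basis v_1, …, v_n, then ∑ λ_j² = tr H² = ∑ deg u ≤ n Δ, so optimum
-- energy ∑ ∣λ_j∣ = n √Δ forces ∑ (∣λ_j∣ − √Δ)² ≤ 0; every λ_j² is then Δ and H² = Δ I.
-- Two vertices at distance 2 in a hypercube have exactly two common neighbours, so the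
-- vanishing of the corresponding entry of H² fixes the product of the arc signs around each
-- 4-cycle. The ratio of the arc signs of two optimum orientations thus has product 1 around
-- every 4-cycle; since the 4-cycles generate the cycle space of a hypercube, this ratio is
-- δ u δ v on each edge u v for some δ : V → {1, −1}, and diag δ is the switching.

module Submission where

open import Algebra.Bundles using (CommutativeMonoid; CommutativeRing)
import Algebra.Properties.CommutativeMonoid.Sum as CommutativeMonoidSum
import Algebra.Properties.CommutativeSemigroup as CommutativeSemigroupProperties
import Algebra.Properties.Group as GroupProperties
import Algebra.Properties.Ring as RingProperties
import Algebra.Properties.Semiring.Sum as SemiringSum
open import Data.Bool.Base using (if_then_else_)
open import Data.Fin.Base using (Fin; zero; suc; combine; punchIn; punchOut; remQuot)
open import Data.Fin.Patterns using (0F; 1F)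
open import Data.Fin.Properties
  using (combine-remQuot; remQuot-combine; punchInᵢ≢i; punchIn-punchOut; punchIn-injective)
  renaming (_≟_ to _≟ᶠ_)
open import Data.Integer.Base as ℤ using (+_)
import Data.Integer.Properties as ℤₚ
open import Data.List.Base using (allFin; filter; length; map; tabulate)
open import Data.List.Extrema.Nat using (xs≤max)
open import Data.List.Membership.Propositional.Properties using (∈-allFin; ∈-map⁺)
import Data.List.Relation.Unary.All as All
open import Data.Nat.Base as ℕ using (ℕ; zero; suc; NonZero)
import Data.Nat.Properties as ℕₚ
open import Data.Product.Base using (∃; _×_; _,_; proj₁; proj₂; uncurry)
open import Data.Rational.Base as ℚ using (ℚ; 0ℚ; 1ℚ; ½)
import Data.Rational.Properties as ℚₚ
open import Data.Rational.Solver using (module +-*-Solver)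
import Data.Rational.Unnormalised.Base as ℚᵘ
import Data.Rational.Unnormalised.Properties as ℚᵘₚ
open import Data.Sign.Base as Sign using (Sign; opposite)
import Data.Sign.Properties as Signₚ
open import Data.Sum.Base using (_⊎_; inj₁; inj₂; [_,_]′)
open import Defs
open import Function.Base using (_∘_)
open import Level using (0ℓ)
open import Relation.Binary.PropositionalEquality
  using (_≡_; _≢_; refl; sym; trans; cong; cong₂; subst; subst₂; module ≡-Reasoning)
import Relation.Binary.Reasoning.Setoid as SetoidReasoning
open import Relation.Nullary using (¬_; Dec; does; contradiction; yes; no)
open import Relation.Unary using (Pred; Decidable)

-- Real and complex arithmetic

-- Real numbers are Cauchy sequences without a decidable order, so no case distinction on a real
-- number is made: the equality case of the energy bound is reached by turning x² ≤ 0 into x ≃ 0. A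
-- `Spectrum` gives a basis of eigenvectors that need not be orthogonal; the trace formula and the
-- scalar form of H² are therefore derived from a dual basis, the inverse of the eigenvector matrix.
-- The passage to H² matters because the eigenvalues √Δ and -√Δ of H differ while their squares
-- agree. Arc signs are antisymmetric, whereas the ratio of two arc signs is symmetric; this makes
-- it a gain function on undirected edges. Generation by 4-cycles is proved by induction on Q_k =
-- Q_(k-1) □ K₂, without cycle spaces: a potential on one layer is extended along the rungs, and the
-- squares standing on the edges of Q_(k-1) make it correct on the other layer.

≡⇒≃ : ∀ {x y} → (∀ n → seq x n ≡ seq y n) → x ≃ y
≡⇒≃ {x} {y} x≡y = mk≃ λ ε 0<ε → 0 , λ n _ →
  subst (ℚ._< ε) (sym (trans (cong (λ p → ℚ.∣ p ℚ.- seq y n ∣) (x≡y n))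
    (cong ℚ.∣_∣ (ℚₚ.+-inverseʳ (seq y n))))) 0<ε

≃-refl : ∀ {x} → x ≃ x
≃-refl = ≡⇒≃ λ _ → refl

≃-sym : ∀ {x y} → x ≃ y → y ≃ x
≃-sym {x} {y} x≃y = mk≃ λ ε 0<ε → let N , p = difference→0 x≃y ε 0<ε in
  N , λ n N≤n → subst (ℚ._< ε) (∣p-q∣≡∣q-p∣ (seq x n) (seq y n)) (p n N≤n)

+ʳ-cong : ∀ {x x′ y y′} → x ≃ x′ → y ≃ y′ → x +ʳ y ≃ x′ +ʳ y′
+ʳ-cong {x} {x′} {y} {y′} x≃x′ y≃y′ = mk≃ λ ε 0<ε →
  let M , p = difference→0 x≃x′ (½ ℚ.* ε) (half-pos 0<ε)
      N , q = difference→0 y≃y′ (½ ℚ.* ε) (half-pos 0<ε)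
  in M ℕ.⊔ N , λ n M⊔N≤n → begin-strict
    ℚ.∣ (seq x n ℚ.+ seq y n) ℚ.- (seq x′ n ℚ.+ seq y′ n) ∣
      ≡⟨ cong ℚ.∣_∣ (solve 4 (λ a b c d → (a :+ b) :- (c :+ d) := (a :- c) :+ (b :- d))
                      refl (seq x n) (seq y n) (seq x′ n) (seq y′ n)) ⟩
    ℚ.∣ (seq x n ℚ.- seq x′ n) ℚ.+ (seq y n ℚ.- seq y′ n) ∣
      ≤⟨ ℚₚ.∣p+q∣≤∣p∣+∣q∣ (seq x n ℚ.- seq x′ n) (seq y n ℚ.- seq y′ n) ⟩
    ℚ.∣ seq x n ℚ.- seq x′ n ∣ ℚ.+ ℚ.∣ seq y n ℚ.- seq y′ n ∣
      <⟨ ℚₚ.+-mono-< (p n (ℕₚ.m⊔n≤o⇒m≤o M N M⊔N≤n)) (q n (ℕₚ.m⊔n≤o⇒n≤o M N M⊔N≤n)) ⟩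
    ½ ℚ.* ε ℚ.+ ½ ℚ.* ε
      ≡⟨ halves ε ⟩
    ε ∎
  where
  open ℚₚ.≤-Reasoning
  open +-*-Solver

-ʳ-cong : ∀ {x y} → x ≃ y → -ʳ x ≃ -ʳ y
-ʳ-cong {x} {y} x≃y = mk≃ λ ε 0<ε → let N , p = difference→0 x≃y ε 0<ε in
  N , λ n N≤n → subst (ℚ._< ε)
    (trans (sym (ℚₚ.∣-p∣≡∣p∣ (seq x n ℚ.- seq y n)))
      (cong ℚ.∣_∣ (solve 2 (λ a b → :- (a :- b) := (:- a) :- (:- b)) refl (seq x n) (seq y n))))
    (p n N≤n)
  where open +-*-Solver

-- Adding the two equations and cancelling the approximations of `y` reuses the ε/2 argument of
-- `+ʳ-cong`.
≃-trans : ∀ {x y z} → x ≃ y → y ≃ z → x ≃ z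
≃-trans {x} {y} {z} x≃y y≃z = mk≃ λ ε 0<ε →
  let N , p = difference→0 (+ʳ-cong x≃y y≃z) ε 0<ε in
  N , λ n N≤n → subst (ℚ._< ε)
    (cong ℚ.∣_∣ (solve 3 (λ a b c → (a :+ b) :- (b :+ c) := a :- c)
                  refl (seq x n) (seq y n) (seq z n)))
    (p n N≤n)
  where open +-*-Solver

*ʳ-cong : ∀ {x x′ y y′} → x ≃ x′ → y ≃ y′ → x *ʳ y ≃ x′ *ʳ y′
*ʳ-cong {x} {x′} {y} {y′} x≃x′ y≃y′ = mk≃ λ ε 0<ε →
  let B , N₁ , 0<B , ∣x∣≤B  = eventually-bounded (seq x) (cauchy x)
      C , N₂ , 0<C , ∣y′∣≤C = eventually-bounded (seq y′) (cauchy y′)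
      -- The tolerances are δ = ε/(2B) and γ = ε/(2C), so that each summand of a(b - d) + d(a - c)
      -- stays below ε/2.
      δ , 0<δ , Bδ≡ε/2 = scale 0<B (half-pos 0<ε)
      γ , 0<γ , Cγ≡ε/2 = scale 0<C (half-pos 0<ε)
      N₃ , p = difference→0 y≃y′ δ 0<δ
      N₄ , q = difference→0 x≃x′ γ 0<γ
  in (N₁ ℕ.⊔ N₂) ℕ.⊔ (N₃ ℕ.⊔ N₄) , λ n N≤n →
    let N₁₂≤n = ℕₚ.m⊔n≤o⇒m≤o (N₁ ℕ.⊔ N₂) (N₃ ℕ.⊔ N₄) N≤n
        N₃₄≤n = ℕₚ.m⊔n≤o⇒n≤o (N₁ ℕ.⊔ N₂) (N₃ ℕ.⊔ N₄) N≤n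
    in subst (ℚ.∣ seq x n ℚ.* seq y n ℚ.- seq x′ n ℚ.* seq y′ n ∣ ℚ.<_)
      (trans (cong₂ ℚ._+_ Bδ≡ε/2 Cγ≡ε/2) (halves ε))
      (*-difference-< {seq x n} {seq y n} {seq x′ n} {seq y′ n} 0<B 0<C
        (∣x∣≤B n (ℕₚ.m⊔n≤o⇒m≤o N₁ N₂ N₁₂≤n)) (p n (ℕₚ.m⊔n≤o⇒m≤o N₃ N₄ N₃₄≤n))
        (∣y′∣≤C n (ℕₚ.m⊔n≤o⇒n≤o N₁ N₂ N₁₂≤n)) (q n (ℕₚ.m⊔n≤o⇒n≤o N₃ N₄ N₃₄≤n)))

ℝ-commutativeRing : CommutativeRing 0ℓ 0ℓ
ℝ-commutativeRing = record
  { Carrier = ℝ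
  ; _≈_ = _≃_
  ; _+_ = _+ʳ_
  ; _*_ = _*ʳ_
  ; -_  = -ʳ_
  ; 0#  = 0ʳ
  ; 1#  = 1ʳ
  ; isCommutativeRing = record
    { isRing = record
      { +-isAbelianGroup = record
        { isGroup = record
          { isMonoid = record
            { isSemigroup = record
              { isMagma = record
                { isEquivalence = record { refl = ≃-refl ; sym = ≃-sym ; trans = ≃-trans }
                ; ∙-cong = +ʳ-cong
                }
              ; assoc = λ x y z → ≡⇒≃ λ n → ℚₚ.+-assoc (seq x n) (seq y n) (seq z n)
              }
            ; identity = (λ x → ≡⇒≃ λ n → ℚₚ.+-identityˡ (seq x n))
                       , (λ x → ≡⇒≃ λ n → ℚₚ.+-identityʳ (seq x n))
            }
          ; inverse = (λ x → ≡⇒≃ λ n → ℚₚ.+-inverseˡ (seq x n))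
                    , (λ x → ≡⇒≃ λ n → ℚₚ.+-inverseʳ (seq x n))
          ; ⁻¹-cong = -ʳ-cong
          }
        ; comm = λ x y → ≡⇒≃ λ n → ℚₚ.+-comm (seq x n) (seq y n)
        }
      ; *-cong = *ʳ-cong
      ; *-assoc = λ x y z → ≡⇒≃ λ n → ℚₚ.*-assoc (seq x n) (seq y n) (seq z n)
      ; *-identity = (λ x → ≡⇒≃ λ n → ℚₚ.*-identityˡ (seq x n))
                   , (λ x → ≡⇒≃ λ n → ℚₚ.*-identityʳ (seq x n))
      ; distrib = (λ x y z → ≡⇒≃ λ n → ℚₚ.*-distribˡ-+ (seq x n) (seq y n) (seq z n))
                , (λ x y z → ≡⇒≃ λ n → ℚₚ.*-distribʳ-+ (seq x n) (seq y n) (seq z n))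
      }
    ; *-comm = λ x y → ≡⇒≃ λ n → ℚₚ.*-comm (seq x n) (seq y n)
    }
  }

ℂ-commutativeRing : CommutativeRing 0ℓ 0ℓ
ℂ-commutativeRing = record
  { Carrier = ℂ
  ; _≈_ = _≈ᶜ_
  ; _+_ = _+ᶜ_
  ; _*_ = _*ᶜ_
  ; -_  = -ᶜ_
  ; 0#  = 0ᶜ
  ; 1#  = 1ᶜ
  ; isCommutativeRing = record
    { isRing = record
      { +-isAbelianGroup = record
        { isGroup = record
          { isMonoid = record
            { isSemigroup = record
              { isMagma = record
                { isEquivalence = record
                  { refl  = mk≈ᶜ ≃-refl ≃-refl
                  ; sym   = λ p → mk≈ᶜ (≃-sym (re≃ p)) (≃-sym (im≃ p))
                  ; trans = λ p q → mk≈ᶜ (≃-trans (re≃ p) (re≃ q)) (≃-trans (im≃ p) (im≃ q))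
                  }
                ; ∙-cong = λ p q → mk≈ᶜ (+ʳ-cong (re≃ p) (re≃ q)) (+ʳ-cong (im≃ p) (im≃ q))
                }
              ; assoc = λ x y z → mk≈ᶜ (+ʳ-assoc (re x) (re y) (re z)) (+ʳ-assoc (im x) (im y) (im z))
              }
            ; identity = (λ x → mk≈ᶜ (+ʳ-identityˡ (re x)) (+ʳ-identityˡ (im x)))
                       , (λ x → mk≈ᶜ (+ʳ-identityʳ (re x)) (+ʳ-identityʳ (im x)))
            }
          ; inverse = (λ x → mk≈ᶜ (-ʳ-inverseˡ (re x)) (-ʳ-inverseˡ (im x)))
                    , (λ x → mk≈ᶜ (-ʳ-inverseʳ (re x)) (-ʳ-inverseʳ (im x)))
          ; ⁻¹-cong = λ p → mk≈ᶜ (-ʳ-cong (re≃ p)) (-ʳ-cong (im≃ p))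
          }
        ; comm = λ x y → mk≈ᶜ (+ʳ-comm (re x) (re y)) (+ʳ-comm (im x) (im y))
        }
      ; *-cong = λ p q → mk≈ᶜ
          (+ʳ-cong (*ʳ-cong (re≃ p) (re≃ q)) (-ʳ-cong (*ʳ-cong (im≃ p) (im≃ q))))
          (+ʳ-cong (*ʳ-cong (re≃ p) (im≃ q)) (*ʳ-cong (im≃ p) (re≃ q)))
      ; *-assoc = λ x y z → mk≈ᶜ
          (≡⇒≃ λ n → solve 6 (λ a b c d e f →
             (a :* c :- b :* d) :* e :- (a :* d :+ b :* c) :* f
             := a :* (c :* e :- d :* f) :- b :* (c :* f :+ d :* e)) refl
             (seq (re x) n) (seq (im x) n) (seq (re y) n) (seq (im y) n)
             (seq (re z) n) (seq (im z) n))
          (≡⇒≃ λ n → solve 6 (λ a b c d e f →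
             (a :* c :- b :* d) :* f :+ (a :* d :+ b :* c) :* e
             := a :* (c :* f :+ d :* e) :+ b :* (c :* e :- d :* f)) refl
             (seq (re x) n) (seq (im x) n) (seq (re y) n) (seq (im y) n)
             (seq (re z) n) (seq (im z) n))
      ; *-identity = *ᶜ-identityˡ
                   , λ x → ≈ᶜ-trans (*ᶜ-comm x 1ᶜ) (*ᶜ-identityˡ x)
      ; distrib = (λ x y z → *ᶜ-distribˡ x y z)
                , λ x y z → ≈ᶜ-trans (*ᶜ-comm (y +ᶜ z) x) (≈ᶜ-trans (*ᶜ-distribˡ x y z)
                    (mk≈ᶜ (+ʳ-cong (re≃ (*ᶜ-comm x y)) (re≃ (*ᶜ-comm x z)))
                          (+ʳ-cong (im≃ (*ᶜ-comm x y)) (im≃ (*ᶜ-comm x z)))))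
      }
    ; *-comm = *ᶜ-comm
    }
  }
  where
  open +-*-Solver
  open CommutativeRing ℝ-commutativeRing using ()
    renaming ( +-assoc to +ʳ-assoc ; +-comm to +ʳ-comm
             ; +-identityˡ to +ʳ-identityˡ ; +-identityʳ to +ʳ-identityʳ
             ; -‿inverseˡ to -ʳ-inverseˡ ; -‿inverseʳ to -ʳ-inverseʳ )

  ≈ᶜ-trans : ∀ {x y z} → x ≈ᶜ y → y ≈ᶜ z → x ≈ᶜ z
  ≈ᶜ-trans p q = mk≈ᶜ (≃-trans (re≃ p) (re≃ q)) (≃-trans (im≃ p) (im≃ q))

  *ᶜ-comm : ∀ x y → x *ᶜ y ≈ᶜ y *ᶜ x
  *ᶜ-comm x y = mk≈ᶜ
    (≡⇒≃ λ n → solve 4 (λ a b c d → a :* c :- b :* d := c :* a :- d :* b) refl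
       (seq (re x) n) (seq (im x) n) (seq (re y) n) (seq (im y) n))
    (≡⇒≃ λ n → solve 4 (λ a b c d → a :* d :+ b :* c := c :* b :+ d :* a) refl
       (seq (re x) n) (seq (im x) n) (seq (re y) n) (seq (im y) n))

  *ᶜ-identityˡ : ∀ x → 1ᶜ *ᶜ x ≈ᶜ x
  *ᶜ-identityˡ x = mk≈ᶜ
    (≡⇒≃ λ n → solve 2 (λ a b → con 1ℚ :* a :- con 0ℚ :* b := a) refl (seq (re x) n) (seq (im x) n))
    (≡⇒≃ λ n → solve 2 (λ a b → con 1ℚ :* b :+ con 0ℚ :* a := b) refl (seq (re x) n) (seq (im x) n))

  *ᶜ-distribˡ : ∀ x y z → x *ᶜ (y +ᶜ z) ≈ᶜ x *ᶜ y +ᶜ x *ᶜ z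
  *ᶜ-distribˡ x y z = mk≈ᶜ
    (≡⇒≃ λ n → solve 6 (λ a b c d e f →
       a :* (c :+ e) :- b :* (d :+ f) := (a :* c :- b :* d) :+ (a :* e :- b :* f)) refl
       (seq (re x) n) (seq (im x) n) (seq (re y) n) (seq (im y) n)
       (seq (re z) n) (seq (im z) n))
    (≡⇒≃ λ n → solve 6 (λ a b c d e f →
       a :* (d :+ f) :+ b :* (c :+ e) := (a :* d :+ b :* c) :+ (a :* f :+ b :* e)) refl
       (seq (re x) n) (seq (im x) n) (seq (re y) n) (seq (im y) n)
       (seq (re z) n) (seq (im z) n))

-- The order on the reals

≃⇒≤ʳ : ∀ {x y} → x ≃ y → x ≤ʳ y
≃⇒≤ʳ {x} {y} x≃y = mk≤ʳ λ ε 0<ε → let N , p = difference→0 x≃y ε 0<ε in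
  N , λ n N≤n → begin
    seq x n
      ≡⟨ solve 2 (λ a b → a := b :+ (a :- b)) refl (seq x n) (seq y n) ⟩
    seq y n ℚ.+ (seq x n ℚ.- seq y n) ≤⟨ ℚₚ.+-monoʳ-≤ (seq y n) (p≤∣p∣ (seq x n ℚ.- seq y n)) ⟩
    seq y n ℚ.+ ℚ.∣ seq x n ℚ.- seq y n ∣ ≤⟨ ℚₚ.+-monoʳ-≤ (seq y n) (ℚₚ.<⇒≤ (p n N≤n)) ⟩
    seq y n ℚ.+ ε                    ∎
  where
  open ℚₚ.≤-Reasoning
  open +-*-Solver
  p≤∣p∣ : ∀ p → p ℚ.≤ ℚ.∣ p ∣
  p≤∣p∣ p with ℚₚ.≤-total 0ℚ p
  ... | inj₁ 0≤p = ℚₚ.≤-reflexive (sym (ℚₚ.0≤p⇒∣p∣≡p 0≤p))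
  ... | inj₂ p≤0 = ℚₚ.≤-trans p≤0 (ℚₚ.0≤∣p∣ p)

≤ʳ-trans : ∀ {x y z} → x ≤ʳ y → y ≤ʳ z → x ≤ʳ z
≤ʳ-trans {x} {y} {z} x≤y y≤z = mk≤ʳ λ ε 0<ε →
  let M , p = eventually≤ x≤y (½ ℚ.* ε) (half-pos 0<ε)
      N , q = eventually≤ y≤z (½ ℚ.* ε) (half-pos 0<ε)
  in M ℕ.⊔ N , λ n M⊔N≤n → begin
    seq x n                                  ≤⟨ p n (ℕₚ.m⊔n≤o⇒m≤o M N M⊔N≤n) ⟩
    seq y n ℚ.+ ½ ℚ.* ε
      ≤⟨ ℚₚ.+-monoˡ-≤ (½ ℚ.* ε) (q n (ℕₚ.m⊔n≤o⇒n≤o M N M⊔N≤n)) ⟩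
    (seq z n ℚ.+ ½ ℚ.* ε) ℚ.+ ½ ℚ.* ε        ≡⟨ ℚₚ.+-assoc (seq z n) (½ ℚ.* ε) (½ ℚ.* ε) ⟩
    seq z n ℚ.+ (½ ℚ.* ε ℚ.+ ½ ℚ.* ε)        ≡⟨ cong (seq z n ℚ.+_) (halves ε) ⟩
    seq z n ℚ.+ ε                            ∎
  where open ℚₚ.≤-Reasoning

+ʳ-mono-≤ʳ : ∀ {x x′ y y′} → x ≤ʳ x′ → y ≤ʳ y′ → x +ʳ y ≤ʳ x′ +ʳ y′
+ʳ-mono-≤ʳ {x} {x′} {y} {y′} x≤x′ y≤y′ = mk≤ʳ λ ε 0<ε →
  let M , p = eventually≤ x≤x′ (½ ℚ.* ε) (half-pos 0<ε)
      N , q = eventually≤ y≤y′ (½ ℚ.* ε) (half-pos 0<ε)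
  in M ℕ.⊔ N , λ n M⊔N≤n → begin
    seq x n ℚ.+ seq y n
      ≤⟨ ℚₚ.+-mono-≤ (p n (ℕₚ.m⊔n≤o⇒m≤o M N M⊔N≤n)) (q n (ℕₚ.m⊔n≤o⇒n≤o M N M⊔N≤n)) ⟩
    (seq x′ n ℚ.+ ½ ℚ.* ε) ℚ.+ (seq y′ n ℚ.+ ½ ℚ.* ε)
      ≡⟨ solve 3 (λ a b h → (a :+ h) :+ (b :+ h) := (a :+ b) :+ (h :+ h)) refl (seq x′ n) (seq y′ n) (½ ℚ.* ε) ⟩
    (seq x′ n ℚ.+ seq y′ n) ℚ.+ (½ ℚ.* ε ℚ.+ ½ ℚ.* ε)
      ≡⟨ cong ((seq x′ n ℚ.+ seq y′ n) ℚ.+_) (halves ε) ⟩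
    (seq x′ n ℚ.+ seq y′ n) ℚ.+ ε ∎
  where
  open ℚₚ.≤-Reasoning
  open +-*-Solver

pointwise≤⇒≤ʳ : ∀ {x y} → (∀ n → seq x n ℚ.≤ seq y n) → x ≤ʳ y
pointwise≤⇒≤ʳ {x} {y} x≤y = mk≤ʳ λ ε 0<ε → 0 , λ n _ →
  subst (ℚ._≤ seq y n ℚ.+ ε) (ℚₚ.+-identityʳ (seq x n)) (ℚₚ.+-mono-≤ (x≤y n) (ℚₚ.<⇒≤ 0<ε))

0≤p*p : ∀ p → 0ℚ ℚ.≤ p ℚ.* p
0≤p*p p with ℚₚ.≤-total 0ℚ p
... | inj₁ 0≤p = subst (ℚ._≤ p ℚ.* p) (ℚₚ.*-zeroʳ p)
                   (ℚₚ.*-monoˡ-≤-nonNeg p {{ℚ.nonNegative 0≤p}} 0≤p)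
... | inj₂ p≤0 = subst (ℚ._≤ p ℚ.* p) (ℚₚ.*-zeroʳ p)
                   (ℚₚ.*-monoˡ-≤-nonPos p {{ℚ.nonPositive p≤0}} p≤0)

∣p∣*∣p∣≡p*p : ∀ p → ℚ.∣ p ∣ ℚ.* ℚ.∣ p ∣ ≡ p ℚ.* p
∣p∣*∣p∣≡p*p p = trans (sym (ℚₚ.∣p*q∣≡∣p∣*∣q∣ p p)) (ℚₚ.0≤p⇒∣p∣≡p (0≤p*p p))

x*x≤0⇒x≃0 : ∀ {x} → x *ʳ x ≤ʳ 0ʳ → x ≃ 0ʳ
x*x≤0⇒x≃0 {x} x²≤0 = mk≃ λ ε 0<ε →
  -- The inequality is available only up to a tolerance. Taking η² for it gives ∣ x n ∣ ≤ η by
  -- rational comparison, and η = ε/2 makes the final bound strict.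
  let η   = ½ ℚ.* ε
      0<η = half-pos 0<ε
      instance η-pos = ℚ.positive 0<η
      0<η² = subst (ℚ._< η ℚ.* η) (ℚₚ.*-zeroʳ η) (ℚₚ.*-monoʳ-<-pos η 0<η)
      N , p = eventually≤ x²≤0 (η ℚ.* η) 0<η²
      η<ε = subst₂ ℚ._<_ (ℚₚ.+-identityʳ η) (halves ε) (ℚₚ.+-monoʳ-< η 0<η)
  in N , λ n N≤n → subst (ℚ._< ε) (cong ℚ.∣_∣ (sym (ℚₚ.+-identityʳ (seq x n))))
    (ℚₚ.≤-<-trans (root-≤ 0<η (subst₂ ℚ._≤_ refl (ℚₚ.+-identityˡ (η ℚ.* η)) (p n N≤n))) η<ε)
  where
  root-≤ : ∀ {p η} → 0ℚ ℚ.< η → p ℚ.* p ℚ.≤ η ℚ.* η → ℚ.∣ p ∣ ℚ.≤ η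
  root-≤ {p} {η} 0<η p²≤η² with ℚ.∣ p ∣ ℚₚ.≤? η
  ... | yes ∣p∣≤η = ∣p∣≤η
  ... | no  ∣p∣≰η = contradiction refl (ℚₚ.<⇒≢ (ℚₚ.<-≤-trans (begin-strict
      η ℚ.* η             <⟨ ℚₚ.*-monoʳ-<-pos η {{ℚ.positive 0<η}} η<∣p∣ ⟩
      η ℚ.* ℚ.∣ p ∣
        ≤⟨ ℚₚ.*-monoʳ-≤-nonNeg ℚ.∣ p ∣ {{ℚ.nonNegative (ℚₚ.0≤∣p∣ p)}} (ℚₚ.<⇒≤ η<∣p∣) ⟩
      ℚ.∣ p ∣ ℚ.* ℚ.∣ p ∣ ≡⟨ ∣p∣*∣p∣≡p*p p ⟩
      p ℚ.* p             ∎) p²≤η²))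
    where
    open ℚₚ.≤-Reasoning
    η<∣p∣ = ℚₚ.≰⇒> ∣p∣≰η

-- Normalised fractions do not compute for a variable `n`; among unnormalised ones the claim is an
-- identity of integers.
fromℕ-suc : ∀ n → fromℕ (suc n) ≃ 1ʳ +ʳ fromℕ n
fromℕ-suc n = ≡⇒≃ λ _ → ℚₚ.toℚᵘ-injective (begin
  ℚ.toℚᵘ (+ suc n ℚ./ 1)                   ≈⟨ ℚₚ.toℚᵘ-fromℚᵘ (+ suc n ℚᵘ./ 1) ⟩
  + suc n ℚᵘ./ 1
    ≈⟨ ℚᵘ.*≡* (cong (λ p → (+ 1 ℤ.+ p) ℤ.* + 1) (sym (ℤₚ.*-identityʳ (+ n)))) ⟩
  + 1 ℚᵘ./ 1 ℚᵘ.+ + n ℚᵘ./ 1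
    ≈⟨ ℚᵘₚ.+-congʳ (+ 1 ℚᵘ./ 1) (ℚₚ.toℚᵘ-fromℚᵘ (+ n ℚᵘ./ 1)) ⟨
  ℚ.toℚᵘ 1ℚ ℚᵘ.+ ℚ.toℚᵘ (+ n ℚ./ 1)        ≈⟨ ℚₚ.toℚᵘ-homo-+ 1ℚ (+ n ℚ./ 1) ⟨
  ℚ.toℚᵘ (1ℚ ℚ.+ + n ℚ./ 1)                ∎)
  where
  open SetoidReasoning ℚᵘₚ.≃-setoid

fromℕ-mono-≤ : ∀ {m n} → m ℕ.≤ n → fromℕ m ≤ʳ fromℕ n
fromℕ-mono-≤ {m} {n} m≤n = pointwise≤⇒≤ʳ λ _ → ℚₚ.toℚᵘ-cancel-≤ (begin
  ℚ.toℚᵘ (+ m ℚ./ 1)  ≃⟨ ℚₚ.toℚᵘ-fromℚᵘ (+ m ℚᵘ./ 1) ⟩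
  + m ℚᵘ./ 1          ≤⟨ ℚᵘ.*≤* (ℤₚ.*-monoʳ-≤-nonNeg (+ 1) (ℤ.+≤+ m≤n)) ⟩
  + n ℚᵘ./ 1          ≃⟨ ℚₚ.toℚᵘ-fromℚᵘ (+ n ℚᵘ./ 1) ⟨
  ℚ.toℚᵘ (+ n ℚ./ 1)  ∎)
  where open ℚᵘₚ.≤-Reasoning

-- Finite sums of reals and the extremal case

module ℝR = CommutativeRing ℝ-commutativeRing
module ℝΣ = SemiringSum ℝR.semiring

∑ʳ-mono-≤ʳ : ∀ {n} {f g : Fin n → ℝ} → (∀ j → f j ≤ʳ g j) → ∑ʳ f ≤ʳ ∑ʳ g
∑ʳ-mono-≤ʳ {zero}  f≤g = ≃⇒≤ʳ ≃-refl
∑ʳ-mono-≤ʳ {suc n} f≤g = +ʳ-mono-≤ʳ (f≤g zero) (∑ʳ-mono-≤ʳ (f≤g ∘ suc))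

∑ʳ-const : ∀ n x → ∑ʳ {n} (λ _ → x) ≃ fromℕ n *ʳ x
∑ʳ-const zero    x = ≃-sym (ℝR.zeroˡ x)
∑ʳ-const (suc n) x = begin
  x +ʳ ∑ʳ {n} (λ _ → x)       ≈⟨ +ʳ-cong (≃-sym (ℝR.*-identityˡ x)) (∑ʳ-const n x) ⟩
  1ʳ *ʳ x +ʳ fromℕ n *ʳ x     ≈⟨ ℝR.distribʳ x 1ʳ (fromℕ n) ⟨
  (1ʳ +ʳ fromℕ n) *ʳ x        ≈⟨ *ʳ-cong (fromℕ-suc n) ≃-refl ⟨
  fromℕ (suc n) *ʳ x          ∎
  where open SetoidReasoning ℝR.setoid

-- Every rational approximation of a square is nonnegative, so the bounds on sums of squares can be
-- pointwise and carry no tolerance.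
∑ʳ-nonNegative : ∀ {n} (f : Fin n → ℝ) → (∀ j m → 0ℚ ℚ.≤ seq (f j) m) → ∀ m → 0ℚ ℚ.≤ seq (∑ʳ f) m
∑ʳ-nonNegative {zero}  f 0≤f m = ℚₚ.≤-refl
∑ʳ-nonNegative {suc n} f 0≤f m =
  ℚₚ.+-mono-≤ (0≤f zero m) (∑ʳ-nonNegative (f ∘ suc) (0≤f ∘ suc) m)

term≤∑ʳ : ∀ {n} (f : Fin n → ℝ) → (∀ j m → 0ℚ ℚ.≤ seq (f j) m) →
  ∀ j m → seq (f j) m ℚ.≤ seq (∑ʳ f) m
term≤∑ʳ f 0≤f zero m = subst (ℚ._≤ seq (∑ʳ f) m) (ℚₚ.+-identityʳ (seq (f zero) m))
  (ℚₚ.+-monoʳ-≤ (seq (f zero) m) (∑ʳ-nonNegative (f ∘ suc) (0≤f ∘ suc) m))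
term≤∑ʳ f 0≤f (suc j) m = subst (ℚ._≤ seq (∑ʳ f) m) (ℚₚ.+-identityˡ (seq (f (suc j)) m))
  (ℚₚ.+-mono-≤ (0≤f zero m) (term≤∑ʳ (f ∘ suc) (0≤f ∘ suc) j m))

-- Expanding ∑ (∣λⱼ∣ − s)² shows that it is at most 0: the equality case of Cauchy–Schwarz.
extremal⇒squares-equal : ∀ {n} (l : Fin n → ℝ) {s d} → s *ʳ s ≃ d →
  ∑ʳ (λ j → ∣ l j ∣ʳ) ≃ fromℕ n *ʳ s → ∑ʳ (λ j → l j *ʳ l j) ≤ʳ fromℕ n *ʳ d →
  ∀ j → l j *ʳ l j ≃ d
extremal⇒squares-equal {n} l {s} {d} s²≃d ∑∣l∣≃ns ∑l²≤nd j = begin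
  l j *ʳ l j             ≈⟨ ≡⇒≃ (λ m → ∣p∣*∣p∣≡p*p (seq (l j) m)) ⟨
  ∣ l j ∣ʳ *ʳ ∣ l j ∣ʳ   ≈⟨ *ʳ-cong ∣l∣≃s ∣l∣≃s ⟩
  s *ʳ s                 ≈⟨ s²≃d ⟩
  d                      ∎
  where
  open SetoidReasoning ℝR.setoid
  -2s = -ʳ (s +ʳ s)

  deviation : Fin n → ℝ
  deviation j = ∣ l j ∣ʳ +ʳ -ʳ s

  expand : ∀ j → deviation j *ʳ deviation j ≃
    l j *ʳ l j +ʳ (-2s *ʳ ∣ l j ∣ʳ +ʳ s *ʳ s)
  expand j = ≡⇒≃ λ m → trans
    (solve 2 (λ a b → (a :- b) :* (a :- b) := a :* a :+ (:- (b :+ b) :* a :+ b :* b)) refl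
      ℚ.∣ seq (l j) m ∣ (seq s m))
    (cong (ℚ._+ (seq -2s m ℚ.* ℚ.∣ seq (l j) m ∣ ℚ.+ seq s m ℚ.* seq s m))
      (∣p∣*∣p∣≡p*p (seq (l j) m)))
    where open +-*-Solver

  ∑expand : ∑ʳ (λ j → deviation j *ʳ deviation j) ≃
    ∑ʳ (λ j → l j *ʳ l j) +ʳ (-2s *ʳ (fromℕ n *ʳ s) +ʳ fromℕ n *ʳ (s *ʳ s))
  ∑expand = begin
    ∑ʳ (λ j → deviation j *ʳ deviation j)
      ≈⟨ ℝΣ.sum-cong-≋ expand ⟩
    ∑ʳ (λ j → l j *ʳ l j +ʳ (-2s *ʳ ∣ l j ∣ʳ +ʳ s *ʳ s))
      ≈⟨ ℝΣ.∑-distrib-+ (λ j → l j *ʳ l j) (λ j → -2s *ʳ ∣ l j ∣ʳ +ʳ s *ʳ s) ⟩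
    ∑ʳ (λ j → l j *ʳ l j) +ʳ ∑ʳ (λ j → -2s *ʳ ∣ l j ∣ʳ +ʳ s *ʳ s)
      ≈⟨ +ʳ-cong ≃-refl (ℝΣ.∑-distrib-+ (λ j → -2s *ʳ ∣ l j ∣ʳ) (λ _ → s *ʳ s)) ⟩
    ∑ʳ (λ j → l j *ʳ l j) +ʳ (∑ʳ (λ j → -2s *ʳ ∣ l j ∣ʳ) +ʳ ∑ʳ {n} (λ _ → s *ʳ s))
      ≈⟨ +ʳ-cong ≃-refl (+ʳ-cong
           (≃-trans (≃-sym (ℝΣ.*-distribˡ-sum -2s (λ j → ∣ l j ∣ʳ))) (*ʳ-cong ≃-refl ∑∣l∣≃ns))
           (∑ʳ-const n (s *ʳ s))) ⟩
    ∑ʳ (λ j → l j *ʳ l j) +ʳ (-2s *ʳ (fromℕ n *ʳ s) +ʳ fromℕ n *ʳ (s *ʳ s)) ∎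

  cancel : fromℕ n *ʳ d +ʳ (-2s *ʳ (fromℕ n *ʳ s) +ʳ fromℕ n *ʳ (s *ʳ s)) ≃ 0ʳ
  cancel = begin
    fromℕ n *ʳ d +ʳ (-2s *ʳ (fromℕ n *ʳ s) +ʳ fromℕ n *ʳ (s *ʳ s))
      ≈⟨ +ʳ-cong (*ʳ-cong ≃-refl (≃-sym s²≃d)) ≃-refl ⟩
    fromℕ n *ʳ (s *ʳ s) +ʳ (-2s *ʳ (fromℕ n *ʳ s) +ʳ fromℕ n *ʳ (s *ʳ s))
      ≈⟨ ≡⇒≃ (λ m → solve 2 (λ a b → a :* (b :* b) :+ (:- (b :+ b) :* (a :* b) :+ a :* (b :* b))
                      := con 0ℚ) refl (seq (fromℕ n) m) (seq s m)) ⟩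
    0ʳ ∎
    where open +-*-Solver

  ∑deviation²≤0 : ∑ʳ (λ j → deviation j *ʳ deviation j) ≤ʳ 0ʳ
  ∑deviation²≤0 = ≤ʳ-trans (≃⇒≤ʳ ∑expand)
    (≤ʳ-trans (+ʳ-mono-≤ʳ ∑l²≤nd (≃⇒≤ʳ ≃-refl)) (≃⇒≤ʳ cancel))

  deviation≃0 : deviation j ≃ 0ʳ
  deviation≃0 = x*x≤0⇒x≃0 (≤ʳ-trans
    (pointwise≤⇒≤ʳ (term≤∑ʳ (λ j → deviation j *ʳ deviation j) (λ j m → 0≤p*p (seq (deviation j) m)) j))
    ∑deviation²≤0)

  ∣l∣≃s : ∣ l j ∣ʳ ≃ s
  ∣l∣≃s = begin
    ∣ l j ∣ʳ
      ≈⟨ ≡⇒≃ (λ m → solve 2 (λ a b → a := (a :- b) :+ b) refl ℚ.∣ seq (l j) m ∣ (seq s m)) ⟩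
    deviation j +ʳ s  ≈⟨ +ʳ-cong deviation≃0 ≃-refl ⟩
    0ʳ +ʳ s           ≈⟨ ℝR.+-identityˡ s ⟩
    s                 ∎
    where open +-*-Solver

-- Finite sums and linear algebra over a commutative ring

module SupportedSums {c ℓ} (M : CommutativeMonoid c ℓ) where
  open CommutativeMonoid M hiding (refl; sym; trans) renaming (Carrier to A)
  open CommutativeMonoidSum M

  sum-supported₁ : ∀ {n} (f : Fin n → A) i → (∀ j → j ≢ i → f j ≈ ε) → sum f ≈ f i
  sum-supported₁ {suc n} f i f≈ε = begin
    sum f                           ≈⟨ sum-remove {i = i} f ⟩
    f i ∙ sum (λ j → f (punchIn i j))
      ≈⟨ ∙-congˡ (sum-cong-≋ λ j → f≈ε (punchIn i j) (punchInᵢ≢i i j)) ⟩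
    f i ∙ sum {n} (λ _ → ε)         ≈⟨ ∙-congˡ (sum-replicate-zero n) ⟩
    f i ∙ ε                         ≈⟨ identityʳ (f i) ⟩
    f i                             ∎
    where open SetoidReasoning setoid

  sum-supported₂ : ∀ {n} (f : Fin n → A) {i j} → i ≢ j →
    (∀ k → k ≢ i → k ≢ j → f k ≈ ε) → sum f ≈ f i ∙ f j
  sum-supported₂ {suc n} f {i} {j} i≢j f≈ε = begin
    sum f                                 ≈⟨ sum-remove {i = i} f ⟩
    f i ∙ sum (λ k → f (punchIn i k))
      -- Once `i` is removed, the remaining indices run through `punchIn i`, and `j` sits at
      -- `punchOut i≢j`.
      ≈⟨ ∙-congˡ (sum-supported₁ (f ∘ punchIn i) (punchOut i≢j) rest) ⟩
    f i ∙ f (punchIn i (punchOut i≢j))    ≡⟨ cong (λ k → f i ∙ f k) (punchIn-punchOut i≢j) ⟩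
    f i ∙ f j                             ∎
    where
    open SetoidReasoning setoid
    rest : ∀ k → k ≢ punchOut i≢j → f (punchIn i k) ≈ ε
    rest k k≢ = f≈ε (punchIn i k) (punchInᵢ≢i i k) λ eq →
      k≢ (punchIn-injective i k _ (trans eq (sym (punchIn-punchOut i≢j))))

module LinearAlgebra {c ℓ} (R : CommutativeRing c ℓ) where
  open CommutativeRing R hiding (refl) renaming (sym to ≈-sym; trans to ≈-trans)
  open SemiringSum semiring renaming (sum to ∑)
  open SupportedSums +-commutativeMonoid
  open CommutativeSemigroupProperties *-commutativeSemigroup using (x∙yz≈y∙xz; x∙yz≈xz∙y)
  open RingProperties ring using (-‿distribˡ-*)
  open GroupProperties +-group using (x∙y⁻¹≈ε⇒x≈y)
  open SetoidReasoning setoid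

  Vect : ℕ → Set c
  Vect n = Fin n → Carrier

  Mat : ℕ → Set c
  Mat n = Fin n → Fin n → Carrier

  infixl 7 _·ᵥ_ _·ₘ_

  -- Over ℂ these operations unfold to `_·ᵛ_`, `_·ᵐ_` and `combination`, so that the data of a
  -- `Spectrum` can be passed in unchanged.
  _·ᵥ_ : ∀ {n} → Mat n → Vect n → Vect n
  (A ·ᵥ v) k = ∑ λ l → A k l * v l

  _·ₘ_ : ∀ {n} → Mat n → Mat n → Mat n
  (A ·ₘ B) k l = ∑ λ m → A k m * B m l

  linearCombination : ∀ {n} → Vect n → (Fin n → Vect n) → Vect n
  linearCombination c v k = ∑ λ j → c j * v j k

  infix 4 _≈ᵥ_

  _≈ᵥ_ : ∀ {n} → Vect n → Vect n → Set ℓ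
  v ≈ᵥ w = ∀ k → v k ≈ w k

  kronecker : ∀ {n} → Mat n
  kronecker k l with k ≟ᶠ l
  ... | yes _ = 1#
  ... | no  _ = 0#

  kronecker-diagonal : ∀ {n} (k : Fin n) → kronecker k k ≡ 1#
  kronecker-diagonal k with k ≟ᶠ k
  ... | yes _  = refl
  ... | no k≢k = contradiction refl k≢k

  kronecker-offDiagonal : ∀ {n} {k l : Fin n} → k ≢ l → kronecker k l ≡ 0#
  kronecker-offDiagonal {k = k} {l} k≢l with k ≟ᶠ l
  ... | yes k≡l = contradiction k≡l k≢l
  ... | no  _   = refl

  ∑-kroneckerʳ : ∀ {n} (f : Vect n) k → (∑ λ l → f l * kronecker l k) ≈ f k
  ∑-kroneckerʳ f k = begin
    (∑ λ l → f l * kronecker l k) ≈⟨ sum-supported₁ _ k (λ l l≢k → ≈-trans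
                                       (*-congˡ (reflexive (kronecker-offDiagonal l≢k))) (zeroʳ (f l))) ⟩
    f k * kronecker k k            ≡⟨ cong (f k *_) (kronecker-diagonal k) ⟩
    f k * 1#                      ≈⟨ *-identityʳ (f k) ⟩
    f k                            ∎

  ∑-kroneckerˡ : ∀ {n} (f : Vect n) k → (∑ λ l → kronecker k l * f l) ≈ f k
  ∑-kroneckerˡ f k = begin
    (∑ λ l → kronecker k l * f l) ≈⟨ sum-supported₁ _ k (λ l l≢k → ≈-trans
                                       (*-congʳ (reflexive (kronecker-offDiagonal (l≢k ∘ sym)))) (zeroˡ (f l))) ⟩
    kronecker k k * f k            ≡⟨ cong (_* f k) (kronecker-diagonal k) ⟩
    1# * f k                      ≈⟨ *-identityˡ (f k) ⟩
    f k                            ∎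

  ·ₘ-·ᵥ-assoc : ∀ {n} (A B : Mat n) v → (A ·ₘ B) ·ᵥ v ≈ᵥ A ·ᵥ (B ·ᵥ v)
  ·ₘ-·ᵥ-assoc A B v k = begin
    (∑ λ l → (∑ λ m → A k m * B m l) * v l)
      ≈⟨ sum-cong-≋ (λ l → *-distribʳ-sum (v l) (λ m → A k m * B m l)) ⟩
    (∑ λ l → ∑ λ m → A k m * B m l * v l)
      ≈⟨ ∑-comm (λ l m → A k m * B m l * v l) ⟩
    (∑ λ m → ∑ λ l → A k m * B m l * v l)
      ≈⟨ sum-cong-≋ (λ m → sum-cong-≋ λ l → *-assoc (A k m) (B m l) (v l)) ⟩
    (∑ λ m → ∑ λ l → A k m * (B m l * v l))
      ≈⟨ sum-cong-≋ (λ m → *-distribˡ-sum (A k m) (λ l → B m l * v l)) ⟨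
    (∑ λ m → A k m * ∑ λ l → B m l * v l) ∎


  square-eigenvector : ∀ {n} {A : Mat n} {v μ} → A ·ᵥ v ≈ᵥ (λ k → μ * v k) →
    (A ·ₘ A) ·ᵥ v ≈ᵥ (λ k → μ * μ * v k)
  square-eigenvector {A = A} {v} {μ} Av≈μv k = begin
    ((A ·ₘ A) ·ᵥ v) k              ≈⟨ ·ₘ-·ᵥ-assoc A A v k ⟩
    (∑ λ m → A k m * (A ·ᵥ v) m) ≈⟨ sum-cong-≋ (λ m → *-congˡ (Av≈μv m)) ⟩
    (∑ λ m → A k m * (μ * v m)) ≈⟨ sum-cong-≋ (λ m → x∙yz≈y∙xz (A k m) μ (v m)) ⟩
    (∑ λ m → μ * (A k m * v m)) ≈⟨ *-distribˡ-sum μ (λ m → A k m * v m) ⟨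
    μ * (A ·ᵥ v) k                ≈⟨ *-congˡ (Av≈μv k) ⟩
    μ * (μ * v k)                ≈⟨ *-assoc μ μ (v k) ⟨
    μ * μ * v k                  ∎

  module Eigenbasis {n} {A : Mat n} {v : Fin n → Vect n}
    (independent : ∀ c → linearCombination c v ≈ᵥ (λ _ → 0#) → ∀ j → c j ≈ 0#)
    (spanning : ∀ w → ∃ λ c → linearCombination c v ≈ᵥ w)
    (μ : Vect n) (Av≈μv : ∀ j → A ·ᵥ v j ≈ᵥ (λ k → μ j * v j k)) where

    -- Column `m` holds the coordinates of the `m`-th standard basis vector in the basis `v`. It
    -- plays the part that the conjugate transpose plays for an orthonormal eigenbasis.
    dual : Fin n → Vect n
    dual j m = proj₁ (spanning λ k → kronecker k m) j

    dual-complete : ∀ k m → (∑ λ j → dual j m * v j k) ≈ kronecker k m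
    dual-complete k m = proj₂ (spanning λ k → kronecker k m) k

    -- By `dual-complete`, `dual` is a right inverse of the eigenvector matrix; this makes it a left
    -- inverse. The differences `d` of the two sides are coefficients whose combination is v j - v j
    -- = 0, so independence makes them vanish.
    dual-biorthogonal : ∀ i j → (∑ λ k → dual i k * v j k) ≈ kronecker i j
    dual-biorthogonal i j = x∙y⁻¹≈ε⇒x≈y _ _ (independent d d-vanishes i)
      where
      d : Vect n
      d i = (∑ λ k → dual i k * v j k) + - kronecker i j
      d-vanishes : linearCombination d v ≈ᵥ λ _ → 0#
      d-vanishes m = begin
        (∑ λ i → d i * v i m)
          ≈⟨ sum-cong-≋ (λ i → distribʳ (v i m) _ _) ⟩
        (∑ λ i → (∑ λ k → dual i k * v j k) * v i m + - kronecker i j * v i m)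
          ≈⟨ ∑-distrib-+ _ (λ i → - kronecker i j * v i m) ⟩
        (∑ λ i → (∑ λ k → dual i k * v j k) * v i m) + (∑ λ i → - kronecker i j * v i m)
          ≈⟨ +-cong first second ⟩
        v j m + - v j m
          ≈⟨ -‿inverseʳ (v j m) ⟩
        0# ∎
        where
        first : (∑ λ i → (∑ λ k → dual i k * v j k) * v i m) ≈ v j m
        first = begin
          (∑ λ i → (∑ λ k → dual i k * v j k) * v i m)
            ≈⟨ sum-cong-≋ (λ i → *-distribʳ-sum (v i m) (λ k → dual i k * v j k)) ⟩
          (∑ λ i → ∑ λ k → dual i k * v j k * v i m)
            ≈⟨ ∑-comm (λ i k → dual i k * v j k * v i m) ⟩
          (∑ λ k → ∑ λ i → dual i k * v j k * v i m)
            ≈⟨ sum-cong-≋ (λ k → sum-cong-≋ λ i → x∙yz≈xz∙y (dual i k) (v i m) (v j k)) ⟨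
          (∑ λ k → ∑ λ i → dual i k * (v i m * v j k))
            ≈⟨ sum-cong-≋ (λ k → sum-cong-≋ λ i → *-assoc (dual i k) (v i m) (v j k)) ⟨
          (∑ λ k → ∑ λ i → dual i k * v i m * v j k)
            ≈⟨ sum-cong-≋ (λ k → *-distribʳ-sum (v j k) (λ i → dual i k * v i m)) ⟨
          (∑ λ k → (∑ λ i → dual i k * v i m) * v j k)
            ≈⟨ sum-cong-≋ (λ k → *-congʳ (dual-complete m k)) ⟩
          (∑ λ k → kronecker m k * v j k)
            ≈⟨ ∑-kroneckerˡ (v j) m ⟩
          v j m ∎
        second : (∑ λ i → - kronecker i j * v i m) ≈ - v j m
        second = begin
          (∑ λ i → - kronecker i j * v i m)
            ≈⟨ sum-cong-≋ (λ i → ≈-trans (≈-sym (-‿distribˡ-* (kronecker i j) (v i m)))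
                 (≈-trans (-‿cong (*-comm (kronecker i j) (v i m))) (-‿distribˡ-* (v i m) (kronecker i j)))) ⟩
          (∑ λ i → - v i m * kronecker i j)
            ≈⟨ ∑-kroneckerʳ (λ i → - v i m) j ⟩
          - v j m ∎

    -- Column `m` of `A` is the image of the `m`-th standard basis vector, which `dual-complete`
    -- expands in eigenvectors.
    spectral-decomposition : ∀ k m → A k m ≈ (∑ λ j → μ j * (dual j m * v j k))
    spectral-decomposition k m = begin
      A k m
        ≈⟨ ∑-kroneckerʳ (A k) m ⟨
      (∑ λ l → A k l * kronecker l m)
        ≈⟨ sum-cong-≋ (λ l → *-congˡ (dual-complete l m)) ⟨
      (∑ λ l → A k l * ∑ λ j → dual j m * v j l)
        ≈⟨ sum-cong-≋ (λ l → *-distribˡ-sum (A k l) (λ j → dual j m * v j l)) ⟩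
      (∑ λ l → ∑ λ j → A k l * (dual j m * v j l))
        ≈⟨ ∑-comm (λ l j → A k l * (dual j m * v j l)) ⟩
      (∑ λ j → ∑ λ l → A k l * (dual j m * v j l))
        ≈⟨ sum-cong-≋ (λ j → sum-cong-≋ λ l → x∙yz≈y∙xz (A k l) (dual j m) (v j l)) ⟩
      (∑ λ j → ∑ λ l → dual j m * (A k l * v j l))
        ≈⟨ sum-cong-≋ (λ j → *-distribˡ-sum (dual j m) (λ l → A k l * v j l)) ⟨
      (∑ λ j → dual j m * (A ·ᵥ v j) k)
        ≈⟨ sum-cong-≋ (λ j → *-congˡ (Av≈μv j k)) ⟩
      (∑ λ j → dual j m * (μ j * v j k))
        ≈⟨ sum-cong-≋ (λ j → x∙yz≈y∙xz (dual j m) (μ j) (v j k)) ⟩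
      (∑ λ j → μ j * (dual j m * v j k)) ∎

    -- Each rank-one matrix formed from `v j` and `dual j` has trace 1 by biorthogonality.
    trace≈∑eigenvalues : (∑ λ k → A k k) ≈ ∑ μ
    trace≈∑eigenvalues = begin
      (∑ λ k → A k k)
        ≈⟨ sum-cong-≋ (λ k → spectral-decomposition k k) ⟩
      (∑ λ k → ∑ λ j → μ j * (dual j k * v j k))
        ≈⟨ ∑-comm (λ k j → μ j * (dual j k * v j k)) ⟩
      (∑ λ j → ∑ λ k → μ j * (dual j k * v j k))
        ≈⟨ sum-cong-≋ (λ j → *-distribˡ-sum (μ j) (λ k → dual j k * v j k)) ⟨
      (∑ λ j → μ j * ∑ λ k → dual j k * v j k)
        ≈⟨ sum-cong-≋ (λ j → *-congˡ (≈-trans (dual-biorthogonal j j)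
             (reflexive (kronecker-diagonal j)))) ⟩
      (∑ λ j → μ j * 1#)
        ≈⟨ sum-cong-≋ (λ j → *-identityʳ (μ j)) ⟩
      ∑ μ ∎

    -- With one common eigenvalue, the spectral decomposition collapses to `dual-complete`.
    scalar : ∀ {ν} → (∀ j → μ j ≈ ν) → ∀ k m → A k m ≈ ν * kronecker k m
    scalar {ν} μ≈ν k m = begin
      A k m                                       ≈⟨ spectral-decomposition k m ⟩
      (∑ λ j → μ j * (dual j m * v j k))       ≈⟨ sum-cong-≋ (λ j → *-congʳ (μ≈ν j)) ⟩
      (∑ λ j → ν * (dual j m * v j k))         ≈⟨ *-distribˡ-sum ν (λ j → dual j m * v j k) ⟨
      ν * (∑ λ j → dual j m * v j k)           ≈⟨ *-congˡ (dual-complete k m) ⟩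
      ν * kronecker k m                           ∎

    scalar-offDiagonal : ∀ {ν} → (∀ j → μ j ≈ ν) → ∀ {k m} → k ≢ m → A k m ≈ 0#
    scalar-offDiagonal {ν} μ≈ν {k} {m} k≢m = begin
      A k m              ≈⟨ scalar μ≈ν k m ⟩
      ν * kronecker k m  ≡⟨ cong (ν *_) (kronecker-offDiagonal k≢m) ⟩
      ν * 0#             ≈⟨ zeroʳ ν ⟩
      0#                 ∎

  diagonal : ∀ {n} → Vect n → Mat n
  diagonal d k l = d k * kronecker k l

  diagonal-·ₘ : ∀ {n} (d : Vect n) (A : Mat n) k l → (diagonal d ·ₘ A) k l ≈ d k * A k l
  diagonal-·ₘ d A k l = begin
    (∑ λ m → d k * kronecker k m * A m l)
      ≈⟨ sum-cong-≋ (λ m → *-assoc (d k) (kronecker k m) (A m l)) ⟩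
    (∑ λ m → d k * (kronecker k m * A m l)) ≈⟨ *-distribˡ-sum (d k) (λ m → kronecker k m * A m l) ⟨
    d k * (∑ λ m → kronecker k m * A m l)   ≈⟨ *-congˡ (∑-kroneckerˡ (λ m → A m l) k) ⟩
    d k * A k l                             ∎

  ·ₘ-diagonal : ∀ {n} (A : Mat n) (d : Vect n) k l → (A ·ₘ diagonal d) k l ≈ A k l * d l
  ·ₘ-diagonal A d k l = begin
    (∑ λ m → A k m * (d m * kronecker m l))
      ≈⟨ sum-cong-≋ (λ m → *-assoc (A k m) (d m) (kronecker m l)) ⟨
    (∑ λ m → A k m * d m * kronecker m l)   ≈⟨ ∑-kroneckerʳ (λ m → A k m * d m) l ⟩
    A k l * d l                             ∎

  conjugate-diagonal : ∀ {n} (d : Vect n) (A : Mat n) k l →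
    ((diagonal d ·ₘ A) ·ₘ diagonal d) k l ≈ d k * A k l * d l
  conjugate-diagonal d A k l =
    ≈-trans (·ₘ-diagonal (diagonal d ·ₘ A) d k l) (*-congʳ (diagonal-·ₘ d A k l))

  diagonal-involution : ∀ {n} (d : Vect n) → (∀ k → d k * d k ≈ 1#) → ∀ k l →
    (diagonal d ·ₘ diagonal d) k l ≈ kronecker k l
  diagonal-involution d d²≈1 k l = begin
    (diagonal d ·ₘ diagonal d) k l   ≈⟨ diagonal-·ₘ d (diagonal d) k l ⟩
    d k * (d k * kronecker k l)      ≈⟨ *-assoc (d k) (d k) (kronecker k l) ⟨
    d k * d k * kronecker k l        ≈⟨ *-congʳ (d²≈1 k) ⟩
    1# * kronecker k l               ≈⟨ *-identityˡ (kronecker k l) ⟩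
    kronecker k l                    ∎

  diagonal-diagonal : ∀ {n} (d : Vect n) k → diagonal d k k ≈ d k
  diagonal-diagonal d k = ≈-trans (*-congˡ (reflexive (kronecker-diagonal k))) (*-identityʳ (d k))

  diagonal-offDiagonal : ∀ {n} (d : Vect n) k l → k ≢ l → diagonal d k l ≈ 0#
  diagonal-offDiagonal d k l k≢l =
    ≈-trans (*-congˡ (reflexive (kronecker-offDiagonal k≢l))) (zeroʳ (d k))

  -- For a weighted adjacency matrix the hypothesis says that walks of length 2 from `k` to `m` can
  -- pass only through `l` or `l′`.
  square-offDiagonal : ∀ {n} (A : Mat n) {k m l l′} → l ≢ l′ →
    (∀ p → p ≢ l → p ≢ l′ → A k p ≈ 0# ⊎ A p m ≈ 0#) →
    (A ·ₘ A) k m ≈ A k l * A l m + A k l′ * A l′ m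
  square-offDiagonal A {k} {m} l≢l′ vanish = sum-supported₂ _ l≢l′ λ p p≢l p≢l′ → step p (vanish p p≢l p≢l′)
    where
    step : ∀ p → A k p ≈ 0# ⊎ A p m ≈ 0# → A k p * A p m ≈ 0#
    step p (inj₁ z) = ≈-trans (*-congʳ z) (zeroˡ (A p m))
    step p (inj₂ z) = ≈-trans (*-congˡ z) (zeroʳ (A k p))

-- Four-cycles in hypercubes

-- Phrased relative to a given 4-cycle, because its use is to single out `b` and `d` as the only
-- midpoints between `a` and `c`.
K₂₃-Free : Graph → Set
K₂₃-Free G = ∀ {a c b d e} → a ≢ c → b ≢ d → a ~ b → b ~ c → a ~ d → d ~ c → a ~ e → e ~ c →
  e ≡ b ⊎ e ≡ d
  where open Graph G

-- Gain functions with trivial gain on every 4-cycle are coboundaries.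
FourCyclesGenerate : Graph → Set
FourCyclesGenerate G = (r : Vertex → Vertex → Sign) →
  (∀ {a b} → a ~ b → r a b ≡ r b a) →
  (∀ {a b c d} → a ≢ c → b ≢ d → a ~ b → b ~ c → a ~ d → d ~ c →
    r a b Sign.* r b c ≡ r a d Sign.* r d c) →
  ∃ λ (δ : Vertex → Sign) → ∀ {a b} → a ~ b → r a b ≡ δ a Sign.* δ b
  where open Graph G

-- Vacuous: a path `a`, `b`, `c` with distinct ends needs three vertices.
K₂-K₂₃-free : K₂₃-Free K₂
K₂-K₂₃-free {0F} {0F}      a≢c = contradiction refl a≢c
K₂-K₂₃-free {1F} {1F}      a≢c = contradiction refl a≢c
K₂-K₂₃-free {0F} {1F} {0F} _ _ a≢b = contradiction refl a≢b
K₂-K₂₃-free {0F} {1F} {1F} _ _ _ b≢c = contradiction refl b≢c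
K₂-K₂₃-free {1F} {0F} {1F} _ _ a≢b = contradiction refl a≢b
K₂-K₂₃-free {1F} {0F} {0F} _ _ _ b≢c = contradiction refl b≢c

K₂-fourCyclesGenerate : FourCyclesGenerate K₂
K₂-fourCyclesGenerate r r-sym _ = δ , r≡δδ
  where
  δ : Fin 2 → Sign
  δ 0F = Sign.+
  δ 1F = r 0F 1F
  r≡δδ : ∀ {a b} → a ≢ b → r a b ≡ δ a Sign.* δ b
  r≡δδ {0F} {0F} a≢a = contradiction refl a≢a
  r≡δδ {0F} {1F} _   = refl
  r≡δδ {1F} {0F} a≢b = trans (r-sym a≢b) (sym (Signₚ.*-identityʳ _))
  r≡δδ {1F} {1F} a≢a = contradiction refl a≢a

≢∧≢⇒≡ : ∀ {i j k : Fin 2} → k ≢ i → i ≢ j → k ≡ j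
≢∧≢⇒≡ {0F} {0F}      _   i≢j = contradiction refl i≢j
≢∧≢⇒≡ {1F} {1F}      _   i≢j = contradiction refl i≢j
≢∧≢⇒≡ {0F} {1F} {0F} k≢i _   = contradiction refl k≢i
≢∧≢⇒≡ {0F} {1F} {1F} _   _   = refl
≢∧≢⇒≡ {1F} {0F} {0F} _   _   = refl
≢∧≢⇒≡ {1F} {0F} {1F} k≢i _   = contradiction refl k≢i

module Prism (G : Graph) where
  open Graph G using (Vertex) renaming (_~_ to _~ᴳ_; ~-sym to ~ᴳ-sym; ~-irrefl to ~ᴳ-irrefl)
  open Graph (G □ K₂) using () renaming (Vertex to PrismVertex; _~_ to _~ᴾ_)

  pair : PrismVertex → Vertex × Fin 2
  pair = remQuot 2

  combine-pair : ∀ a → uncurry combine (pair a) ≡ a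
  combine-pair = combine-remQuot {Graph.order G} 2

  pair-injective : ∀ {a b} → pair a ≡ pair b → a ≡ b
  pair-injective {a} {b} eq = trans (sym (combine-pair a))
    (trans (cong (uncurry combine) eq) (combine-pair b))

  -- The relation to which `_~ᴾ_` unfolds along `pair`; on explicit pairs, layers can be matched on.
  Adjacent : Vertex × Fin 2 → Vertex × Fin 2 → Set
  Adjacent (u , i) (u′ , j) = (u ≡ u′ × i ≢ j) ⊎ (u ~ᴳ u′ × i ≡ j)

  adjacent⇒~ : ∀ {u i u′ j} → Adjacent (u , i) (u′ , j) → combine u i ~ᴾ combine u′ j
  adjacent⇒~ {u} {i} {u′} {j} = subst₂ Adjacent (sym (remQuot-combine u i)) (sym (remQuot-combine u′ j))

  -- Two rungs in succession return to the starting vertex, and a single rung would end in the other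
  -- layer; hence both steps are edges of `G`.
  commonNeighbour-sameLayer : ∀ {u u′ w i l} → u ≢ u′ →
    Adjacent (u , i) (w , l) → Adjacent (w , l) (u′ , i) → l ≡ i × u ~ᴳ w × w ~ᴳ u′
  commonNeighbour-sameLayer u≢u′ (inj₁ (refl , _)) (inj₁ (refl , _)) = contradiction refl u≢u′
  commonNeighbour-sameLayer u≢u′ (inj₁ (_ , i≢l)) (inj₂ (_ , l≡i))   = contradiction (sym l≡i) i≢l
  commonNeighbour-sameLayer u≢u′ (inj₂ (_ , i≡l)) (inj₁ (_ , l≢i))   = contradiction (sym i≡l) l≢i
  commonNeighbour-sameLayer u≢u′ (inj₂ (u~w , i≡l)) (inj₂ (w~u′ , _)) = sym i≡l , u~w , w~u′

  -- A change of layer in two steps uses exactly one rung, and taking it first or last determines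
  -- the midpoint.
  commonNeighbour-otherLayer : ∀ {u u′ w i j l} → i ≢ j →
    Adjacent (u , i) (w , l) → Adjacent (w , l) (u′ , j) →
    (w , l) ≡ (u , j) ⊎ (w , l) ≡ (u′ , i)
  commonNeighbour-otherLayer i≢j (inj₁ (u≡w , i≢l)) (inj₁ (_ , l≢j)) =
    contradiction (≢∧≢⇒≡ (λ l≡i → i≢l (sym l≡i)) i≢j) l≢j
  commonNeighbour-otherLayer i≢j (inj₁ (u≡w , _)) (inj₂ (_ , l≡j)) = inj₁ (cong₂ _,_ (sym u≡w) l≡j)
  commonNeighbour-otherLayer i≢j (inj₂ (_ , i≡l)) (inj₁ (w≡u′ , _)) = inj₂ (cong₂ _,_ w≡u′ (sym i≡l))
  commonNeighbour-otherLayer i≢j (inj₂ (_ , i≡l)) (inj₂ (_ , l≡j)) = contradiction (trans i≡l l≡j) i≢j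

  -- Between different layers there are just two candidates, which `b` and `d` exhaust; within one
  -- layer the whole configuration lies in a copy of `G`.
  K₂₃-free : K₂₃-Free G → K₂₃-Free (G □ K₂)
  K₂₃-free free {a} {c} {b} {d} {e} a≢c b≢d a~b b~c a~d d~c a~e e~c
    with proj₂ (pair a) ≟ᶠ proj₂ (pair c)
  ... | no i≢j = among (commonNeighbour-otherLayer i≢j a~b b~c)
                       (commonNeighbour-otherLayer i≢j a~d d~c)
                       (commonNeighbour-otherLayer i≢j a~e e~c)
    where
    among : ∀ {x y} → pair b ≡ x ⊎ pair b ≡ y → pair d ≡ x ⊎ pair d ≡ y →
            pair e ≡ x ⊎ pair e ≡ y → e ≡ b ⊎ e ≡ d
    among (inj₁ p) (inj₁ q) _        = contradiction (pair-injective (trans p (sym q))) b≢d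
    among (inj₂ p) (inj₂ q) _        = contradiction (pair-injective (trans p (sym q))) b≢d
    among (inj₁ p) (inj₂ q) (inj₁ s) = inj₁ (pair-injective (trans s (sym p)))
    among (inj₁ p) (inj₂ q) (inj₂ s) = inj₂ (pair-injective (trans s (sym q)))
    among (inj₂ p) (inj₁ q) (inj₁ s) = inj₂ (pair-injective (trans s (sym q)))
    among (inj₂ p) (inj₁ q) (inj₂ s) = inj₁ (pair-injective (trans s (sym p)))
  ... | yes i≡j = lift (inLayer a~b b~c) (inLayer a~d d~c) (inLayer a~e e~c)
    where
    u≢u′ : proj₁ (pair a) ≢ proj₁ (pair c)
    u≢u′ u≡u′ = a≢c (pair-injective (cong₂ _,_ u≡u′ i≡j))
    inLayer : ∀ {x} → a ~ᴾ x → x ~ᴾ c → proj₂ (pair x) ≡ proj₂ (pair a) ×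
              proj₁ (pair a) ~ᴳ proj₁ (pair x) × proj₁ (pair x) ~ᴳ proj₁ (pair c)
    inLayer {x} a~x x~c = commonNeighbour-sameLayer u≢u′ a~x
      (subst (λ j → Adjacent (pair x) (proj₁ (pair c) , j)) (sym i≡j) x~c)
    lift : _ → _ → _ → e ≡ b ⊎ e ≡ d
    lift (b₂ , ab , bc) (d₂ , ad , dc) (e₂ , ae , ec)
      with free u≢u′ (λ b₁≡d₁ → b≢d (pair-injective (cong₂ _,_ b₁≡d₁ (trans b₂ (sym d₂)))))
             ab bc ad dc ae ec
    ... | inj₁ e₁≡b₁ = inj₁ (pair-injective (cong₂ _,_ e₁≡b₁ (trans e₂ (sym b₂))))
    ... | inj₂ e₁≡d₁ = inj₂ (pair-injective (cong₂ _,_ e₁≡d₁ (trans e₂ (sym d₂))))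

  fourCyclesGenerate : FourCyclesGenerate G → FourCyclesGenerate (G □ K₂)
  fourCyclesGenerate generate r r-sym r-balanced = δ , λ {a} {b} a~b →
    trans (cong₂ r (sym (combine-pair a)) (sym (combine-pair b)))
          (r≡δδ (pair a) (pair b) a~b)
    where
    combine-≢ : ∀ {u i u′ j} → (u , i) ≢ (u′ , j) → combine u i ≢ combine {n = 2} u′ j
    combine-≢ {u} {i} {u′} {j} ≢ eq = ≢ (trans (sym (remQuot-combine u i))
      (trans (cong pair eq) (remQuot-combine u′ j)))

    layer₀ : ∃ λ (δ₀ : Vertex → Sign) → ∀ {u u′} → u ~ᴳ u′ →
      r (combine u 0F) (combine u′ 0F) ≡ δ₀ u Sign.* δ₀ u′
    layer₀ = generate (λ u u′ → r (combine u 0F) (combine u′ 0F))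
      (λ u~u′ → r-sym (adjacent⇒~ (inj₂ (u~u′ , refl))))
      (λ a≢c b≢d ab bc ad dc → r-balanced
        (combine-≢ λ eq → a≢c (cong proj₁ eq)) (combine-≢ λ eq → b≢d (cong proj₁ eq))
        (adjacent⇒~ (inj₂ (ab , refl))) (adjacent⇒~ (inj₂ (bc , refl)))
        (adjacent⇒~ (inj₂ (ad , refl))) (adjacent⇒~ (inj₂ (dc , refl))))

    δ₀ = proj₁ layer₀

    rung : Vertex → Sign
    rung u = r (combine u 0F) (combine u 1F)

    δᵖ : Vertex × Fin 2 → Sign
    δᵖ (u , 0F) = δ₀ u
    -- Forced by the rung at `u`: the product of the values at its two ends must be `rung u`.
    δᵖ (u , 1F) = δ₀ u Sign.* rung u

    δ : PrismVertex → Sign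
    δ a = δᵖ (pair a)

    cancel : ∀ s t → s Sign.* (s Sign.* t) ≡ t
    cancel s t = trans (sym (Signₚ.*-assoc s s t)) (cong (Sign._* t) (Signₚ.s*s≡+ s))

    -- Balance of the 4-cycle formed by an edge of `G`, its copy and the two rungs: the two ways
    -- from the lower end over `u` to the upper end over `u′` have equal gain.
    square : ∀ {u u′} → u ~ᴳ u′ →
      rung u Sign.* r (combine u 1F) (combine u′ 1F)
        ≡ (δ₀ u Sign.* δ₀ u′) Sign.* rung u′
    square {u} {u′} u~u′ = trans
      (r-balanced (combine-≢ λ eq → 0≢1 (cong proj₂ eq)) (combine-≢ λ eq → 0≢1 (sym (cong proj₂ eq)))
        (adjacent⇒~ (inj₁ (refl , 0≢1))) (adjacent⇒~ (inj₂ (u~u′ , refl)))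
        (adjacent⇒~ (inj₂ (u~u′ , refl))) (adjacent⇒~ (inj₁ (refl , 0≢1))))
      (cong (Sign._* rung u′) (proj₂ layer₀ u~u′))
      where
      0≢1 : _≢_ {A = Fin 2} 0F 1F
      0≢1 ()

    r≡δδ : ∀ p q → Adjacent p q → r (uncurry combine p) (uncurry combine q) ≡ δᵖ p Sign.* δᵖ q
    r≡δδ (u , 0F) (u′ , 0F) (inj₂ (u~u′ , _)) = proj₂ layer₀ u~u′
    r≡δδ (u , 1F) (u′ , 1F) (inj₂ (u~u′ , _)) = begin
      r (combine u 1F) (combine u′ 1F)                              ≡⟨ cancel (rung u) _ ⟨
      rung u Sign.* (rung u Sign.* r (combine u 1F) (combine u′ 1F))
        ≡⟨ cong (rung u Sign.*_) (square u~u′) ⟩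
      rung u Sign.* (δ₀ u Sign.* δ₀ u′ Sign.* rung u′)
        ≡⟨ cong (rung u Sign.*_) (Signₚ.*-assoc (δ₀ u) (δ₀ u′) (rung u′)) ⟩
      rung u Sign.* (δ₀ u Sign.* (δ₀ u′ Sign.* rung u′))
        ≡⟨ Signₚ.*-assoc (rung u) (δ₀ u) _ ⟨
      rung u Sign.* δ₀ u Sign.* (δ₀ u′ Sign.* rung u′)
        ≡⟨ cong (Sign._* (δ₀ u′ Sign.* rung u′)) (Signₚ.*-comm (rung u) (δ₀ u)) ⟩
      δ₀ u Sign.* rung u Sign.* (δ₀ u′ Sign.* rung u′)              ∎
      where open ≡-Reasoning
    r≡δδ (u , 0F) (.u , 1F) (inj₁ (refl , _)) = sym (cancel (δ₀ u) (rung u))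
    r≡δδ (u , 1F) (.u , 0F) (inj₁ (refl , 1≢0)) =
      trans (r-sym (adjacent⇒~ (inj₁ (refl , 1≢0))))
        (trans (sym (cancel (δ₀ u) (rung u))) (Signₚ.*-comm (δ₀ u) (δ₀ u Sign.* rung u)))
    r≡δδ (u , 0F) (u′ , 0F) (inj₁ (_ , 0≢0)) = contradiction refl 0≢0
    r≡δδ (u , 1F) (u′ , 1F) (inj₁ (_ , 1≢1)) = contradiction refl 1≢1
    r≡δδ (u , 0F) (u′ , 1F) (inj₂ (_ , ()))
    r≡δδ (u , 1F) (u′ , 0F) (inj₂ (_ , ()))

hypercube-K₂₃-free : ∀ k .{{_ : NonZero k}} → K₂₃-Free (hypercube k)
hypercube-K₂₃-free 1             {a} = K₂-K₂₃-free {a}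
hypercube-K₂₃-free (suc (suc k)) = Prism.K₂₃-free (hypercube (suc k)) (hypercube-K₂₃-free (suc k))

hypercube-fourCyclesGenerate : ∀ k .{{_ : NonZero k}} → FourCyclesGenerate (hypercube k)
hypercube-fourCyclesGenerate 1             = K₂-fourCyclesGenerate
hypercube-fourCyclesGenerate (suc (suc k)) =
  Prism.fourCyclesGenerate (hypercube (suc k)) (hypercube-fourCyclesGenerate (suc k))

-- Hermitian-adjacency matrices

module ℂR = CommutativeRing ℂ-commutativeRing
module ℂL = LinearAlgebra ℂ-commutativeRing

-- The two are given by separate `with` clauses and agree only after the case split.
identity≡kronecker : ∀ {n} (k l : Fin n) → identity k l ≡ ℂL.kronecker k l
identity≡kronecker k l with k ≟ᶠ l
... | yes _ = refl
... | no  _ = refl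

-- Nonzero matrix entries are ±i and switching entries ±1; encoding them by `Sign` turns equations
-- up to `_≈ᶜ_` into propositional ones.
sgn ι : Sign → ℂ
sgn Sign.+ = 1ᶜ
sgn Sign.- = -ᶜ 1ᶜ
ι Sign.+ = i
ι Sign.- = -ᶜ i

sgn-*-sgn : ∀ s t → sgn s *ᶜ sgn t ≈ᶜ sgn (s Sign.* t)
sgn-*-sgn Sign.+ Sign.+ = mk≈ᶜ (≡⇒≃ λ _ → refl) (≡⇒≃ λ _ → refl)
sgn-*-sgn Sign.+ Sign.- = mk≈ᶜ (≡⇒≃ λ _ → refl) (≡⇒≃ λ _ → refl)
sgn-*-sgn Sign.- Sign.+ = mk≈ᶜ (≡⇒≃ λ _ → refl) (≡⇒≃ λ _ → refl)
sgn-*-sgn Sign.- Sign.- = mk≈ᶜ (≡⇒≃ λ _ → refl) (≡⇒≃ λ _ → refl)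

sgn-*-ι : ∀ s t → sgn s *ᶜ ι t ≈ᶜ ι (s Sign.* t)
sgn-*-ι Sign.+ Sign.+ = mk≈ᶜ (≡⇒≃ λ _ → refl) (≡⇒≃ λ _ → refl)
sgn-*-ι Sign.+ Sign.- = mk≈ᶜ (≡⇒≃ λ _ → refl) (≡⇒≃ λ _ → refl)
sgn-*-ι Sign.- Sign.+ = mk≈ᶜ (≡⇒≃ λ _ → refl) (≡⇒≃ λ _ → refl)
sgn-*-ι Sign.- Sign.- = mk≈ᶜ (≡⇒≃ λ _ → refl) (≡⇒≃ λ _ → refl)

ι-*-ι : ∀ s t → ι s *ᶜ ι t ≈ᶜ sgn (opposite (s Sign.* t))
ι-*-ι Sign.+ Sign.+ = mk≈ᶜ (≡⇒≃ λ _ → refl) (≡⇒≃ λ _ → refl)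
ι-*-ι Sign.+ Sign.- = mk≈ᶜ (≡⇒≃ λ _ → refl) (≡⇒≃ λ _ → refl)
ι-*-ι Sign.- Sign.+ = mk≈ᶜ (≡⇒≃ λ _ → refl) (≡⇒≃ λ _ → refl)
ι-*-ι Sign.- Sign.- = mk≈ᶜ (≡⇒≃ λ _ → refl) (≡⇒≃ λ _ → refl)

-- Equal signs would sum to ±2, which is not within ε = 1 of zero.
sgn-+-sgn≈0 : ∀ s t → sgn s +ᶜ sgn t ≈ᶜ 0ᶜ → s ≡ opposite t
sgn-+-sgn≈0 Sign.+ Sign.+ eq =
  contradiction (proj₂ (difference→0 (re≃ eq) 1ℚ 0<1) _ ℕₚ.≤-refl)
    λ { (ℚ.*<* (ℤ.+<+ (ℕ.s≤s ()))) }
sgn-+-sgn≈0 Sign.- Sign.- eq =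
  contradiction (proj₂ (difference→0 (re≃ eq) 1ℚ 0<1) _ ℕₚ.≤-refl)
    λ { (ℚ.*<* (ℤ.+<+ (ℕ.s≤s ()))) }
sgn-+-sgn≈0 Sign.+ Sign.- _ = refl
sgn-+-sgn≈0 Sign.- Sign.+ _ = refl

ι-products-cancel : ∀ s t s′ t′ → ι s *ᶜ ι t +ᶜ ι s′ *ᶜ ι t′ ≈ᶜ 0ᶜ →
  s Sign.* t ≡ opposite (s′ Sign.* t′)
ι-products-cancel s t s′ t′ eq = Signₚ.opposite-injective
  (sgn-+-sgn≈0 (opposite (s Sign.* t)) (opposite (s′ Sign.* t′))
    (ℂR.trans (ℂR.sym (ℂR.+-cong (ι-*-ι s t) (ι-*-ι s′ t′))) eq))

indicator : ∀ {P : Set} → Dec P → ℝ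
indicator P? = if does P? then 1ʳ else 0ʳ

∑ʳ-indicator : ∀ {A : Set} {P : Pred A 0ℓ} (P? : Decidable P) {n} (f : Fin n → A) →
  ∑ʳ (λ j → indicator (P? (f j))) ≃ fromℕ (length (filter P? (tabulate f)))
∑ʳ-indicator P? {zero}  f = ≃-refl
∑ʳ-indicator P? {suc n} f with P? (f zero)
... | yes _ = ≃-trans (+ʳ-cong ≃-refl (∑ʳ-indicator P? (f ∘ suc)))
                  (≃-sym (fromℕ-suc (length (filter P? (tabulate (f ∘ suc))))))
... | no  _ = ≃-trans (ℝR.+-identityˡ _) (∑ʳ-indicator P? (f ∘ suc))

degree≤maxDegree : ∀ G u → Graph.degree G u ℕ.≤ Graph.maxDegree G
degree≤maxDegree G u = All.lookup (xs≤max 0 (map degree (allFin order))) (∈-map⁺ degree (∈-allFin u))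
  where open Graph G

re-∑ᶜ : ∀ {n} (f : Fin n → ℂ) → re (∑ᶜ f) ≃ ∑ʳ (re ∘ f)
re-∑ᶜ {zero}  f = ≃-refl
re-∑ᶜ {suc n} f = +ʳ-cong ≃-refl (re-∑ᶜ (f ∘ suc))

-- Arc signs and the squared matrix of one orientation

module _ {G : Graph} (φ : Orientation G) where
  open Graph G
  open Orientation φ

  private
    H : Matrix order
    H = hermitianAdjacency φ

  -- Off the edges the value is - by default; the facts about it are all stated on edges.
  arcSign : Vertex → Vertex → Sign
  arcSign u v = if does (u ⟶? v) then Sign.+ else Sign.-

  hermitian-edge : ∀ {u v} → u ~ v → H u v ≡ ι (arcSign u v)
  hermitian-edge {u} {v} u~v with u ⟶? v | v ⟶? u
  ... | yes _   | _       = refl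
  ... | no  _   | yes _   = refl
  ... | no  u↛v | no  v↛u = contradiction (edge⇒arc u~v) [ u↛v , v↛u ]′

  hermitian-nonEdge : ∀ {u v} → ¬ u ~ v → H u v ≡ 0ᶜ
  hermitian-nonEdge {u} {v} u≁v with u ⟶? v | v ⟶? u
  ... | yes u→v | _       = contradiction (arc⇒edge u→v) u≁v
  ... | no  _   | yes v→u = contradiction (~-sym (arc⇒edge v→u)) u≁v
  ... | no  _   | no  _   = refl

  nonPath-vanish : ∀ {u v w} → ¬ (u ~ v × v ~ w) → H u v ≈ᶜ 0ᶜ ⊎ H v w ≈ᶜ 0ᶜ
  nonPath-vanish {u} {v} {w} ¬path with u ~? v | v ~? w
  ... | no u≁v  | _       = inj₁ (ℂR.reflexive (hermitian-nonEdge u≁v))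
  ... | yes _   | no v≁w  = inj₂ (ℂR.reflexive (hermitian-nonEdge v≁w))
  ... | yes u~v | yes v~w = contradiction (u~v , v~w) ¬path

  arcSign-opposite : ∀ {u v} → u ~ v → arcSign v u ≡ opposite (arcSign u v)
  arcSign-opposite {u} {v} u~v with u ⟶? v | v ⟶? u
  ... | yes u→v | yes v→u = contradiction v→u (asym u→v)
  ... | yes _   | no  _   = refl
  ... | no  _   | yes _   = refl
  ... | no  u↛v | no  v↛u = contradiction (edge⇒arc u~v) [ u↛v , v↛u ]′

  -- On an edge the product is i(-i) = 1, so the diagonal of H² counts neighbours.
  re-H*H : ∀ u v → re (H u v *ᶜ H v u) ≃ indicator (u ~? v)
  re-H*H u v with u ~? v
  ... | yes u~v rewrite hermitian-edge u~v | hermitian-edge (~-sym u~v) | arcSign-opposite u~v =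
    re≃ (ι-*-ι′ (arcSign u v))
    where
    ι-*-ι′ : ∀ s → ι s *ᶜ ι (opposite s) ≈ᶜ 1ᶜ
    ι-*-ι′ s = subst (λ t → ι s *ᶜ ι (opposite s) ≈ᶜ sgn (opposite t))
      (Signₚ.s*opposite[s]≡- s) (ι-*-ι s (opposite s))
  ... | no u≁v rewrite hermitian-nonEdge u≁v = re≃ (ℂR.zeroˡ (H v u))

  -- Only real numbers can be compared, so the trace enters through its real part, which is a sum of
  -- degrees.
  trace-H²≤ : re (∑ᶜ λ u → (H ·ᵐ H) u u) ≤ʳ fromℕ order *ʳ fromℕ maxDegree
  trace-H²≤ = ≤ʳ-trans (≃⇒≤ʳ (≃-trans (re-∑ᶜ λ u → (H ·ᵐ H) u u) (ℝΣ.sum-cong-≋ re-H²≃degree)))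
    (≤ʳ-trans (∑ʳ-mono-≤ʳ λ u → fromℕ-mono-≤ (degree≤maxDegree G u))
      (≃⇒≤ʳ (∑ʳ-const order (fromℕ maxDegree))))
    where
    re-H²≃degree : ∀ u → re ((H ·ᵐ H) u u) ≃ fromℕ (degree u)
    re-H²≃degree u = ≃-trans (re-∑ᶜ λ v → H u v *ᶜ H v u)
      (≃-trans (ℝΣ.sum-cong-≋ (re-H*H u)) (∑ʳ-indicator (u ~?_) (λ v → v)))

  optimum⇒H²-offDiagonal : HasOptimumEnergy φ → ∀ {u v} → u ≢ v → (H ·ᵐ H) u v ≈ᶜ 0ᶜ
  optimum⇒H²-offDiagonal (e , s , (S , e≃∑∣l∣) , (_ , s²≃Δ) , e≃ns) {u} {v} u≢v =
    E.scalar-offDiagonal l²≈Δ u≢v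
    where
    l : Fin order → ℝ
    l = eigenvalue S

    -- The eigenbasis of H also serves H², with squared eigenvalues; these are the ones that turn
    -- out to be all equal.
    module E = ℂL.Eigenbasis {A = H ·ᵐ H} {v = eigenvector S}
      (IsBasis.independent (isBasis S)) (IsBasis.spanning (isBasis S))
      (λ j → fromℝ (l j) *ᶜ fromℝ (l j))
      (λ j → ℂL.square-eigenvector {A = H} {v = eigenvector S j} {μ = fromℝ (l j)} (isEigen S j))

    fromℝ-* : ∀ x → fromℝ x *ᶜ fromℝ x ≈ᶜ fromℝ (x *ʳ x)
    fromℝ-* x = mk≈ᶜ
      (≡⇒≃ λ n → solve 1 (λ a → a :* a :- con 0ℚ :* con 0ℚ := a :* a) refl (seq x n))
      (≡⇒≃ λ n → solve 1 (λ a → a :* con 0ℚ :+ con 0ℚ :* a := con 0ℚ) refl (seq x n))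
      where open +-*-Solver

    ∑l²≤nΔ : ∑ʳ (λ j → l j *ʳ l j) ≤ʳ fromℕ order *ʳ fromℕ maxDegree
    ∑l²≤nΔ = ≤ʳ-trans (≃⇒≤ʳ (≃-sym (≃-trans (re≃ E.trace≈∑eigenvalues)
      (≃-trans (re-∑ᶜ λ j → fromℝ (l j) *ᶜ fromℝ (l j))
        (ℝΣ.sum-cong-≋ λ j → re≃ (fromℝ-* (l j)))))))
      trace-H²≤

    l²≈Δ : ∀ j → fromℝ (l j) *ᶜ fromℝ (l j) ≈ᶜ fromℝ (fromℕ maxDegree)
    l²≈Δ j = ℂR.trans (fromℝ-* (l j))
      (mk≈ᶜ (extremal⇒squares-equal l s²≃Δ (≃-trans (≃-sym e≃∑∣l∣) e≃ns) ∑l²≤nΔ j) ≃-refl)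

  -- In H² = Δ I the entry at (a , c) has only two nonzero summands.
  optimum⇒4-cycle-negative : K₂₃-Free G → HasOptimumEnergy φ →
    ∀ {a b c d} → a ≢ c → b ≢ d → a ~ b → b ~ c → a ~ d → d ~ c →
    arcSign a b Sign.* arcSign b c ≡ opposite (arcSign a d Sign.* arcSign d c)
  optimum⇒4-cycle-negative free opt {a} {b} {c} {d} a≢c b≢d a~b b~c a~d d~c =
    ι-products-cancel (arcSign a b) (arcSign b c) (arcSign a d) (arcSign d c) products-cancel
    where
    vanish : ∀ e → e ≢ b → e ≢ d → H a e ≈ᶜ 0ᶜ ⊎ H e c ≈ᶜ 0ᶜ
    vanish e e≢b e≢d = nonPath-vanish λ (a~e , e~c) →
      [ e≢b , e≢d ]′ (free a≢c b≢d a~b b~c a~d d~c a~e e~c)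

    products-cancel : ι (arcSign a b) *ᶜ ι (arcSign b c) +ᶜ ι (arcSign a d) *ᶜ ι (arcSign d c) ≈ᶜ 0ᶜ
    products-cancel = subst (_≈ᶜ 0ᶜ)
      (cong₂ _+ᶜ_ (cong₂ _*ᶜ_ (hermitian-edge a~b) (hermitian-edge b~c))
                  (cong₂ _*ᶜ_ (hermitian-edge a~d) (hermitian-edge d~c)))
      (ℂR.trans (ℂR.sym (ℂL.square-offDiagonal H {a} {c} {b} {d} b≢d vanish)) (optimum⇒H²-offDiagonal opt a≢c))

-- Switching from the ratio of two orientations

module _ {G : Graph} (φ₁ φ₂ : Orientation G) where
  open Graph G

  private
    σ₁ σ₂ : Vertex → Vertex → Sign
    σ₁ = arcSign φ₁
    σ₂ = arcSign φ₂

  signRatio : Vertex → Vertex → Sign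
  signRatio u v = σ₁ u v Sign.* σ₂ u v

  -- Reversing an edge flips both arc signs, and the two flips cancel in the product.
  signRatio-sym : ∀ {u v} → u ~ v → signRatio u v ≡ signRatio v u
  signRatio-sym {u} {v} u~v
    rewrite arcSign-opposite φ₁ u~v | arcSign-opposite φ₂ u~v with σ₁ u v
  ... | Sign.+ = sym (Signₚ.opposite-involutive _)
  ... | Sign.- = refl

  coboundary⇒switchingEquivalent : (δ : Vertex → Sign) →
    (∀ {u v} → u ~ v → signRatio u v ≡ δ u Sign.* δ v) → SwitchingEquivalent φ₁ φ₂
  coboundary⇒switchingEquivalent δ r≡δδ = D , D , isSign , (D² , D²) , conjugate
    where
    open SetoidReasoning ℂR.setoid
    D : Matrix order
    D = ℂL.diagonal (sgn ∘ δ)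

    isSign : IsSignDiagonal D
    isSign = (λ k → entry k (δ k) refl) , ℂL.diagonal-offDiagonal (sgn ∘ δ)
      where
      entry : ∀ k s → δ k ≡ s → D k k ≈ᶜ 1ᶜ ⊎ D k k ≈ᶜ -ᶜ 1ᶜ
      entry k Sign.+ eq = inj₁ (ℂR.trans (ℂL.diagonal-diagonal (sgn ∘ δ) k) (ℂR.reflexive (cong sgn eq)))
      entry k Sign.- eq = inj₂ (ℂR.trans (ℂL.diagonal-diagonal (sgn ∘ δ) k) (ℂR.reflexive (cong sgn eq)))

    D² : D ·ᵐ D ≈ᵐ identity
    D² k l = ℂR.trans
      (ℂL.diagonal-involution (sgn ∘ δ)
        (λ j → ℂR.trans (sgn-*-sgn (δ j) (δ j)) (ℂR.reflexive (cong sgn (Signₚ.s*s≡+ (δ j))))) k l)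
      (ℂR.reflexive (sym (identity≡kronecker k l)))

    H₁ = hermitianAdjacency φ₁
    H₂ = hermitianAdjacency φ₂

    -- Multiply the coboundary equation by σ₁, which is its own inverse. The factors are ordered so
    -- that `sgn-*-ι` can split them off from the left one at a time.
    σ₂≡δσ₁δ : ∀ {u v} → u ~ v → σ₂ u v ≡ δ v Sign.* (δ u Sign.* σ₁ u v)
    σ₂≡δσ₁δ {u} {v} u~v = trans (sym (trans (sym (Signₚ.*-assoc (σ₁ u v) (σ₁ u v) (σ₂ u v)))
        (cong (Sign._* σ₂ u v) (Signₚ.s*s≡+ (σ₁ u v)))))
      (trans (cong (σ₁ u v Sign.*_) (r≡δδ u~v))
        (trans (Signₚ.*-comm (σ₁ u v) (δ u Sign.* δ v))
          (trans (cong (Sign._* σ₁ u v) (Signₚ.*-comm (δ u) (δ v)))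
            (Signₚ.*-assoc (δ v) (δ u) (σ₁ u v)))))

    conjugate : H₂ ≈ᵐ (D ·ᵐ H₁) ·ᵐ D
    conjugate u v = ℂR.trans (core (u ~? v)) (ℂR.sym (ℂL.conjugate-diagonal (sgn ∘ δ) H₁ u v))
      where
      core : Dec (u ~ v) → H₂ u v ≈ᶜ sgn (δ u) *ᶜ H₁ u v *ᶜ sgn (δ v)
      core (yes u~v) = begin
        H₂ u v                                        ≡⟨ hermitian-edge φ₂ u~v ⟩
        ι (σ₂ u v)                                    ≡⟨ cong ι (σ₂≡δσ₁δ u~v) ⟩
        ι (δ v Sign.* (δ u Sign.* σ₁ u v))            ≈⟨ sgn-*-ι (δ v) (δ u Sign.* σ₁ u v) ⟨
        sgn (δ v) *ᶜ ι (δ u Sign.* σ₁ u v)            ≈⟨ ℂR.*-congˡ (sgn-*-ι (δ u) (σ₁ u v)) ⟨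
        sgn (δ v) *ᶜ (sgn (δ u) *ᶜ ι (σ₁ u v))
          ≈⟨ ℂR.*-comm (sgn (δ v)) (sgn (δ u) *ᶜ ι (σ₁ u v)) ⟩
        sgn (δ u) *ᶜ ι (σ₁ u v) *ᶜ sgn (δ v)
          ≡⟨ cong (λ z → sgn (δ u) *ᶜ z *ᶜ sgn (δ v)) (hermitian-edge φ₁ u~v) ⟨
        sgn (δ u) *ᶜ H₁ u v *ᶜ sgn (δ v)              ∎
      core (no u≁v) = begin
        H₂ u v                                        ≡⟨ hermitian-nonEdge φ₂ u≁v ⟩
        0ᶜ                                            ≈⟨ ℂR.zeroˡ (sgn (δ v)) ⟨
        0ᶜ *ᶜ sgn (δ v)                               ≈⟨ ℂR.*-congʳ (ℂR.zeroʳ (sgn (δ u))) ⟨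
        sgn (δ u) *ᶜ 0ᶜ *ᶜ sgn (δ v)
          ≡⟨ cong (λ z → sgn (δ u) *ᶜ z *ᶜ sgn (δ v)) (hermitian-nonEdge φ₁ u≁v) ⟨
        sgn (δ u) *ᶜ H₁ u v *ᶜ sgn (δ v)              ∎

  optimum⇒switchingEquivalent : K₂₃-Free G → FourCyclesGenerate G →
    HasOptimumEnergy φ₁ → HasOptimumEnergy φ₂ → SwitchingEquivalent φ₁ φ₂
  optimum⇒switchingEquivalent free generate opt₁ opt₂ =
    let δ , r≡δδ = generate signRatio signRatio-sym balanced
    in coboundary⇒switchingEquivalent δ r≡δδ
    where
    interchange : ∀ s t s′ t′ → s Sign.* t Sign.* (s′ Sign.* t′) ≡ s Sign.* s′ Sign.* (t Sign.* t′)
    interchange = CommutativeSemigroupProperties.interchange Signₚ.*-commutativeSemigroup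
    opposite-*-opposite : ∀ s t → opposite s Sign.* opposite t ≡ s Sign.* t
    opposite-*-opposite Sign.+ t = Signₚ.opposite-involutive t
    opposite-*-opposite Sign.- t = refl
    -- Each orientation contributes one `opposite` around the 4-cycle, and the two cancel in the
    -- ratio.
    balanced : ∀ {a b c d} → a ≢ c → b ≢ d → a ~ b → b ~ c → a ~ d → d ~ c →
      signRatio a b Sign.* signRatio b c ≡ signRatio a d Sign.* signRatio d c
    balanced {a} {b} {c} {d} a≢c b≢d a~b b~c a~d d~c = trans
      (interchange (σ₁ a b) (σ₂ a b) (σ₁ b c) (σ₂ b c))
      (trans (cong₂ Sign._*_ (optimum⇒4-cycle-negative φ₁ free opt₁ a≢c b≢d a~b b~c a~d d~c)
                             (optimum⇒4-cycle-negative φ₂ free opt₂ a≢c b≢d a~b b~c a~d d~c))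
        (trans (opposite-*-opposite (σ₁ a d Sign.* σ₁ d c) (σ₂ a d Sign.* σ₂ d c))
          (interchange (σ₁ a d) (σ₁ d c) (σ₂ a d) (σ₂ d c))))

theorem4p4 : (k : ℕ) → .{{_ : NonZero k}} → (φ₁ φ₂ : Orientation (hypercube k)) →
    HasOptimumEnergy φ₁ → HasOptimumEnergy φ₂ → SwitchingEquivalent φ₁ φ₂
theorem4p4 k φ₁ φ₂ =
  optimum⇒switchingEquivalent φ₁ φ₂ (hypercube-K₂₃-free k) (hypercube-fourCyclesGenerate k)
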